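{- Let $G$ be a finite connected nonbipartite graph (loops and multiple edges allowed) that is regular of degree $q+1\geq 3$. Then there is a number $\beta\in[q^{ -1/2},1)$ depending only on $G$ such that for every nonempty finite connected subgraph $X$ of the universal cover $\widetilde{G}$ there is a constant $C>0$, depending only on $G$ and $X$, such that for every function $f:V\to\mathbb{R}$ on the vertices of $G$ and every integer $r\geq 0$, $$\Big|\frac{1}{|\mathcal{T}_r(X)|}\sum_{v\in\mathcal{T}_r(X)}\tilde f(v)-\frac{1}{|V|}\sum_{v\in V}f(v)\Big|\leq C\,\|f\|_2\,\beta^r .$$
   Context: $G$ is a graph with vertex set $V$ and edge set $E$; a loop at a vertex contributes $2$ to its degree. The universal cover $\widetilde{G}$ of $G$ is the tree, with vertex set $\widetilde{V}$ and edge set $\widetilde{E}$, constructed as follows: fix a root vertex of $G$; the vertices of $\widetilde{G}$ are the non-backtracking paths in $G$ starting at the root (each edge, including each loop, may be traversed in two mutually inverse directions, and a path is non-backtracking if no step is immediately followed by its inverse); two such paths are neighbours if they differ by exactly one edge at the end. The projection $\pi:\widetilde{G}\to G$ sends a path to its terminal vertex. The lift of $f:V\to\mathbb{R}$ is $\tilde f=f\circ\pi:\widetilde{V}\to\mathbb{R}$, and $\|f\|_2=\big(\sum_{v\in V}f(v)^2\big)^{1/2}$. Let $\delta$ be the combinatorial distance on $\widetilde{G}$. For a connected subgraph $X$ of $\widetilde{G}$ with vertex set $V(X)$, the tube of radius $r$ around $X$ is $$\mathcal{T}_r(X)=\{v\in\widetilde{V}:\min_{x\in V(X)}\delta(v,x)=r\}.$$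 -}

module Defs where

open import Data.Bool using (Bool; true; false; not)
import Data.Bool.Properties as Bool
open import Data.Empty using (⊥; ⊥-elim)
open import Data.Fin using (Fin)
import Data.Fin.Properties as Fin
open import Data.Integer as ℤ using (+_; -[1+_]; +[1+_])
import Data.Integer.Properties as ℤ
open import Data.List using (List; []; _∷_; length; map; concatMap; mapMaybe; filter; foldr;
  deduplicate; allFin; cartesianProduct; drop)
import Data.List.Properties as List
open import Data.List.Membership.Propositional using (_∈_; lose; find)
open import Data.List.Membership.Propositional.Properties using (∈-map⁺; ∈-concatMap⁺; ∈-filter⁺;
  ∈-filter⁻; ∈-deduplicate⁺; ∈-deduplicate⁻; ∈-allFin; ∈-cartesianProduct⁺)
open import Data.List.Relation.Unary.All as All using (All)
open import Data.List.Relation.Unary.Any as Any using (Any; here; there)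
import Data.List.Relation.Unary.Any.Properties as Any
open import Data.List.Relation.Unary.Unique.Propositional using (Unique)
open import Data.List.Relation.Unary.Unique.DecPropositional.Properties using (deduplicate-!)
open import Data.Maybe using (Maybe; just; nothing)
import Data.Maybe.Relation.Unary.Any as MAny
open import Data.Nat as ℕ using (ℕ; zero; suc)
import Data.Nat.Properties as ℕ
open import Data.Product using (Σ-syntax; ∃-syntax; _×_; _,_; proj₁; proj₂)
import Data.Product.Properties as Product
open import Data.Rational as ℚ using (ℚ; 0ℚ; 1ℚ; ½; _/_; mkℚ)
import Data.Rational.Properties as ℚ
open import Data.Rational.Unnormalised as ℚᵘ using (mkℚᵘ)
import Data.Rational.Unnormalised.Properties as ℚᵘ
open import Data.Sum using (_⊎_; inj₁; inj₂)
open import Data.Unit using (⊤; tt)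
open import Function using (_⇔_; mk⇔)
open import Relation.Binary using (Rel; DecidableEquality; Decidable)
open import Relation.Binary.Construct.Closure.ReflexiveTransitive using (Star)
open import Relation.Binary.PropositionalEquality using (_≡_; _≢_; refl; sym; trans; cong; cong₂;
  subst; subst₂)
open import Relation.Nullary using (Dec; yes; no; ¬_; ¬?)
open import Relation.Nullary.Decidable using (_×-dec_; _⊎-dec_; map′)
open import Relation.Nullary.Decidable.Core using (dec⇒maybe)
open import Level using (0ℓ)
open import Tactic.RingSolver using (solve-∀)
open import Tactic.RingSolver.Core.AlmostCommutativeRing using (AlmostCommutativeRing; fromCommutativeRing)

-- Real numbers are Cauchy sequences of rationals carrying a modulus of convergence.  Equality of
-- reals is not _≡_ but having difference tending to 0; _≤ℝ_ and _<ℝ_ below respect it.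
record ℝ : Set where
  field
    seq    : ℕ → ℚ
    cauchy : ∀ ε → 0ℚ ℚ.< ε → ∃[ N ] (∀ m n → N ℕ.≤ m → N ℕ.≤ n →
               ℚ.∣ seq m ℚ.- seq n ∣ ℚ.< ε)

open ℝ public

infix 4 _≤ℝ_ _<ℝ_

_≤ℝ_ : ℝ → ℝ → Set
x ≤ℝ y = ∀ ε → 0ℚ ℚ.< ε → ∃[ N ] (∀ n → N ℕ.≤ n → seq x n ℚ.≤ seq y n ℚ.+ ε)

_<ℝ_ : ℝ → ℝ → Set
x <ℝ y = ∃[ ε ] 0ℚ ℚ.< ε × ∃[ N ] (∀ n → N ℕ.≤ n → seq x n ℚ.+ ε ℚ.≤ seq y n)

private
  ℚ-ring : AlmostCommutativeRing 0ℓ 0ℓ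
  ℚ-ring = fromCommutativeRing ℚ.+-*-commutativeRing (λ p → dec⇒maybe (0ℚ ℚ.≟ p))

  ring2 : ∀ a b → a ℚ.+ b ℚ.- b ≡ a
  ring2 = solve-∀ ℚ-ring

  ring3 : ∀ a b → a ℚ.- b ℚ.+ b ≡ a
  ring3 = solve-∀ ℚ-ring

  ring4 : ∀ a b → a ≡ a ℚ.- b ℚ.+ b
  ring4 = solve-∀ ℚ-ring

  ring5 : ∀ a b c d → (a ℚ.- b) ℚ.+ (c ℚ.- d) ≡ (a ℚ.+ c) ℚ.- (b ℚ.+ d)
  ring5 = solve-∀ ℚ-ring

  ring6 : ∀ a b → a ℚ.- b ≡ ℚ.- b ℚ.- (ℚ.- a)
  ring6 = solve-∀ ℚ-ring

  ring7 : ∀ a b c d → a ℚ.* (c ℚ.- d) ℚ.+ d ℚ.* (a ℚ.- b) ≡ a ℚ.* c ℚ.- b ℚ.* d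
  ring7 = solve-∀ ℚ-ring

  ring8 : ∀ a b → b ℚ.- a ≡ ℚ.- (a ℚ.- b)
  ring8 = solve-∀ ℚ-ring

  ring9 : ∀ a b → b ℚ.+ (a ℚ.- b) ≡ a
  ring9 = solve-∀ ℚ-ring

  ring10 : ∀ a b → a ℚ.* a ℚ.+ b ℚ.* b ℚ.+ (a ℚ.* b ℚ.+ a ℚ.* b) ≡ (a ℚ.+ b) ℚ.* (a ℚ.+ b)
  ring10 = solve-∀ ℚ-ring

  ring11 : ∀ a b → a ℚ.+ b ℚ.- a ≡ b
  ring11 = solve-∀ ℚ-ring

halve : ∀ ε → 0ℚ ℚ.< ε → ∃[ h ] 0ℚ ℚ.< h × h ℚ.+ h ≡ ε
halve ε ε>0 = ½ ℚ.* ε , subst (ℚ._< ½ ℚ.* ε) (ℚ.*-zeroʳ ½) (ℚ.*-monoʳ-<-pos ½ ε>0) ,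
  trans (sym (ℚ.*-distribʳ-+ ε ½ ½)) (ℚ.*-identityˡ ε)

divide : ∀ K ε → 0ℚ ℚ.< K → 0ℚ ℚ.< ε → ∃[ δ ] 0ℚ ℚ.< δ × K ℚ.* δ ≡ ε
divide K ε K>0 ε>0 = ℚ.1/ K ℚ.* ε ,
    subst (ℚ._< ℚ.1/ K ℚ.* ε) (ℚ.*-zeroʳ (ℚ.1/ K)) (ℚ.*-monoʳ-<-pos (ℚ.1/ K) ε>0) ,
    trans (sym (ℚ.*-assoc K (ℚ.1/ K) ε)) (trans (cong (ℚ._* ε) (ℚ.*-inverseʳ K)) (ℚ.*-identityˡ ε))
  where
  instance
    K-pos : ℚ.Positive K
    K-pos = ℚ.positive K>0
    K-nonZero : ℚ.NonZero K
    K-nonZero = ℚ.pos⇒nonZero K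
    1/K-pos : ℚ.Positive (ℚ.1/ K)
    1/K-pos = ℚ.1/pos⇒pos K

p≤∣p∣ : ∀ p → p ℚ.≤ ℚ.∣ p ∣
p≤∣p∣ p with ℚ.≤-total 0ℚ p
... | inj₁ 0≤p = ℚ.≤-reflexive (sym (ℚ.0≤p⇒∣p∣≡p 0≤p))
... | inj₂ p≤0 = ℚ.≤-trans p≤0 (ℚ.0≤∣p∣ p)

∣∣-< : ∀ {p e} → p ℚ.< e → ℚ.- p ℚ.< e → ℚ.∣ p ∣ ℚ.< e
∣∣-< {p} {e} p<e -p<e with ℚ.∣p∣≡p∨∣p∣≡-p p
... | inj₁ eq = subst (ℚ._< e) (sym eq) p<e
... | inj₂ eq = subst (ℚ._< e) (sym eq) -p<e

∣p∣-∣q∣≤∣p-q∣ : ∀ p q → ℚ.∣ p ∣ ℚ.- ℚ.∣ q ∣ ℚ.≤ ℚ.∣ p ℚ.- q ∣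
∣p∣-∣q∣≤∣p-q∣ p q = subst (ℚ.∣ p ∣ ℚ.- ℚ.∣ q ∣ ℚ.≤_)
    (ring2 ℚ.∣ p ℚ.- q ∣ ℚ.∣ q ∣)
    (ℚ.+-monoˡ-≤ (ℚ.- ℚ.∣ q ∣)
      (subst (λ t → ℚ.∣ t ∣ ℚ.≤ ℚ.∣ p ℚ.- q ∣ ℚ.+ ℚ.∣ q ∣)
        (ring3 p q)
        (ℚ.∣p+q∣≤∣p∣+∣q∣ (p ℚ.- q) q)))

≤⊔ˡ : ∀ {k} m n → m ℕ.⊔ n ℕ.≤ k → m ℕ.≤ k
≤⊔ˡ m n = ℕ.≤-trans (ℕ.m≤m⊔n m n)

≤⊔ʳ : ∀ {k} m n → m ℕ.⊔ n ℕ.≤ k → n ℕ.≤ k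
≤⊔ʳ m n = ℕ.≤-trans (ℕ.m≤n⊔m m n)

bounded : ∀ x → ∃[ A ] 0ℚ ℚ.< A × ∃[ N ] (∀ n → N ℕ.≤ n → ℚ.∣ seq x n ∣ ℚ.≤ A)
bounded x with cauchy x 1ℚ (ℚ.positive⁻¹ 1ℚ)
... | N , close = A , A>0 , N , λ n N≤n →
    ℚ.≤-trans (ℚ.≤-reflexive (cong ℚ.∣_∣ (ring4 (seq x n) (seq x N))))
      (ℚ.≤-trans (ℚ.∣p+q∣≤∣p∣+∣q∣ (seq x n ℚ.- seq x N) (seq x N))
        (ℚ.+-monoˡ-≤ ℚ.∣ seq x N ∣ (ℚ.<⇒≤ (close n N N≤n ℕ.≤-refl))))
  where
  A : ℚ
  A = 1ℚ ℚ.+ ℚ.∣ seq x N ∣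
  A>0 : 0ℚ ℚ.< A
  A>0 = ℚ.<-≤-trans (ℚ.positive⁻¹ 1ℚ)
    (subst (ℚ._≤ A) (ℚ.+-identityʳ 1ℚ) (ℚ.+-monoʳ-≤ 1ℚ (ℚ.0≤∣p∣ (seq x N))))

fromℚ : ℚ → ℝ
fromℚ p .seq _ = p
fromℚ p .cauchy ε ε>0 = 0 , λ _ _ _ _ →
  subst (ℚ._< ε) (sym (cong ℚ.∣_∣ (ℚ.+-inverseʳ p))) ε>0

0ℝ 1ℝ : ℝ
0ℝ = fromℚ 0ℚ
1ℝ = fromℚ 1ℚ

infixl 6 _+ℝ_ _-ℝ_
infixl 7 _*ℝ_
infixr 8 _^ℝ_
infix  9 √_

_+ℝ_ : ℝ → ℝ → ℝ
(x +ℝ y) .seq n = seq x n ℚ.+ seq y n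
(x +ℝ y) .cauchy ε ε>0 =
  let h , h>0 , h+h≡ε = halve ε ε>0
      M , closeˣ = cauchy x h h>0
      N , closeʸ = cauchy y h h>0
  in M ℕ.⊔ N , λ m n m≥ n≥ →
    subst₂ (λ t e → ℚ.∣ t ∣ ℚ.< e) (ring5 (seq x m) (seq x n) (seq y m) (seq y n)) h+h≡ε
      (ℚ.≤-<-trans (ℚ.∣p+q∣≤∣p∣+∣q∣ (seq x m ℚ.- seq x n) (seq y m ℚ.- seq y n))
        (ℚ.+-mono-< (closeˣ m n (≤⊔ˡ M N m≥) (≤⊔ˡ M N n≥)) (closeʸ m n (≤⊔ʳ M N m≥) (≤⊔ʳ M N n≥))))

-ℝ_ : ℝ → ℝ
(-ℝ x) .seq n = ℚ.- seq x n
(-ℝ x) .cauchy ε ε>0 with cauchy x ε ε>0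
... | N , close = N , λ m n m≥ n≥ →
    subst (λ t → ℚ.∣ t ∣ ℚ.< ε)
      (ring6 (seq x n) (seq x m)) (close n m n≥ m≥)

_-ℝ_ : ℝ → ℝ → ℝ
x -ℝ y = x +ℝ (-ℝ y)

product-close : ∀ {K δ h ε} a b c d → 0ℚ ℚ.< K → K ℚ.* δ ≡ h → h ℚ.+ h ≡ ε →
  ℚ.∣ a ∣ ℚ.≤ K → ℚ.∣ d ∣ ℚ.≤ K → ℚ.∣ a ℚ.- b ∣ ℚ.< δ → ℚ.∣ c ℚ.- d ∣ ℚ.< δ →
  ℚ.∣ a ℚ.* c ℚ.- b ℚ.* d ∣ ℚ.< ε
product-close {K} {δ} {h} a b c d K>0 Kδ≡h h+h≡ε a≤K d≤K ab<δ cd<δ =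
    subst₂ (λ t e → ℚ.∣ t ∣ ℚ.< e) (ring7 a b c d) h+h≡ε
      (ℚ.≤-<-trans (ℚ.∣p+q∣≤∣p∣+∣q∣ (a ℚ.* (c ℚ.- d)) (d ℚ.* (a ℚ.- b)))
        (ℚ.+-mono-< (scale a (c ℚ.- d) a≤K cd<δ) (scale d (a ℚ.- b) d≤K ab<δ)))
  where
  scale : ∀ p q → ℚ.∣ p ∣ ℚ.≤ K → ℚ.∣ q ∣ ℚ.< δ → ℚ.∣ p ℚ.* q ∣ ℚ.< h
  scale p q p≤ q< = subst₂ ℚ._<_ (sym (ℚ.∣p*q∣≡∣p∣*∣q∣ p q)) Kδ≡h
    (ℚ.≤-<-trans (ℚ.*-monoʳ-≤-nonNeg ℚ.∣ q ∣ {{ℚ.∣-∣-nonNeg q}} p≤)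
      (ℚ.*-monoʳ-<-pos K {{ℚ.positive K>0}} q<))

_*ℝ_ : ℝ → ℝ → ℝ
(x *ℝ y) .seq n = seq x n ℚ.* seq y n
(x *ℝ y) .cauchy ε ε>0 =
  let A , A>0 , M , x≤A = bounded x
      B , B>0 , N , y≤B = bounded y
      K>0 = subst (ℚ._< A ℚ.+ B) (ℚ.+-identityˡ 0ℚ) (ℚ.+-mono-< A>0 B>0)
      h , h>0 , h+h≡ε = halve ε ε>0
      δ , δ>0 , Kδ≡h = divide (A ℚ.+ B) h K>0 h>0
      M′ , closeˣ = cauchy x δ δ>0
      N′ , closeʸ = cauchy y δ δ>0
      P = M ℕ.⊔ N
      P′ = M′ ℕ.⊔ N′
  in P ℕ.⊔ P′ , λ m n m≥ n≥ →
    product-close (seq x m) (seq x n) (seq y m) (seq y n) K>0 Kδ≡h h+h≡ε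
      (ℚ.≤-trans (x≤A m (≤⊔ˡ M N (≤⊔ˡ P P′ m≥)))
        (subst (ℚ._≤ A ℚ.+ B) (ℚ.+-identityʳ A) (ℚ.+-monoʳ-≤ A (ℚ.<⇒≤ B>0))))
      (ℚ.≤-trans (y≤B n (≤⊔ʳ M N (≤⊔ˡ P P′ n≥)))
        (subst (ℚ._≤ A ℚ.+ B) (ℚ.+-identityˡ B) (ℚ.+-monoˡ-≤ B (ℚ.<⇒≤ A>0))))
      (closeˣ m n (≤⊔ˡ M′ N′ (≤⊔ʳ P P′ m≥)) (≤⊔ˡ M′ N′ (≤⊔ʳ P P′ n≥)))
      (closeʸ m n (≤⊔ʳ M′ N′ (≤⊔ʳ P P′ m≥)) (≤⊔ʳ M′ N′ (≤⊔ʳ P P′ n≥)))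

∣_∣ℝ : ℝ → ℝ
∣ x ∣ℝ .seq n = ℚ.∣ seq x n ∣
∣ x ∣ℝ .cauchy ε ε>0 with cauchy x ε ε>0
... | N , close = N , λ m n m≥ n≥ →
    ∣∣-< (ℚ.≤-<-trans (∣p∣-∣q∣≤∣p-q∣ (seq x m) (seq x n)) (close m n m≥ n≥))
      (subst (ℚ._< ε)
        (ring8 ℚ.∣ seq x m ∣ ℚ.∣ seq x n ∣)
        (ℚ.≤-<-trans (∣p∣-∣q∣≤∣p-q∣ (seq x n) (seq x m)) (close n m n≥ m≥)))

_^ℝ_ : ℝ → ℕ → ℝ
x ^ℝ zero  = 1ℝ
x ^ℝ suc n = x *ℝ x ^ℝ n

-- grid p u j is the greatest multiple i u with i ≤ j and (i u)² ≤ p, or 0 if there is none.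
grid : ℚ → ℚ → ℕ → ℚ
grid p u zero = 0ℚ
grid p u (suc j) with ((+ suc j / 1) ℚ.* u) ℚ.* ((+ suc j / 1) ℚ.* u) ℚ.≤? p
... | yes _ = (+ suc j / 1) ℚ.* u
... | no  _ = grid p u j

-- The square root of p from below, on the grid of mesh 1 / suc n; the search may stop at the
-- natural number suc ∣ numerator p ∣, which exceeds p.
√-approx : ℚ → ℕ → ℚ
√-approx p n = grid p (+ 1 / suc n) (suc ℤ.∣ ℚ.↥ p ∣ ℕ.* suc n)

0≤u : ∀ n → 0ℚ ℚ.≤ + 1 / suc n
0≤u n = ℚ.<⇒≤ (ℚ.positive⁻¹ (+ 1 / suc n) {{ℚ.normalize-pos 1 (suc n)}})

0≤* : ∀ {p q} → 0ℚ ℚ.≤ p → 0ℚ ℚ.≤ q → 0ℚ ℚ.≤ p ℚ.* q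
0≤* {p} {q} 0≤p 0≤q = subst (ℚ._≤ p ℚ.* q) (ℚ.*-zeroʳ p)
  (ℚ.*-monoˡ-≤-nonNeg p {{ℚ.nonNegative 0≤p}} 0≤q)

0≤+ : ∀ {p q} → 0ℚ ℚ.≤ p → 0ℚ ℚ.≤ q → 0ℚ ℚ.≤ p ℚ.+ q
0≤+ {p} {q} 0≤p 0≤q = subst (ℚ._≤ p ℚ.+ q) (ℚ.+-identityˡ 0ℚ) (ℚ.+-mono-≤ 0≤p 0≤q)

0≤ι : ∀ j → 0ℚ ℚ.≤ + j / 1
0≤ι j = ℚ.nonNegative⁻¹ (+ j / 1) {{ℚ.normalize-nonNeg j 1}}

sq-mono : ∀ {p q} → 0ℚ ℚ.≤ p → p ℚ.≤ q → p ℚ.* p ℚ.≤ q ℚ.* q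
sq-mono {p} {q} 0≤p p≤q = ℚ.≤-trans (ℚ.*-monoˡ-≤-nonNeg p {{ℚ.nonNegative 0≤p}} p≤q)
  (ℚ.*-monoʳ-≤-nonNeg q {{ℚ.nonNegative (ℚ.≤-trans 0≤p p≤q)}} p≤q)

ι-suc : ∀ j → + suc j / 1 ≡ + j / 1 ℚ.+ 1ℚ
ι-suc j = ℚ.toℚᵘ-injective (ℚᵘ.≃-trans (ℚ.toℚᵘ-fromℚᵘ (mkℚᵘ (+ suc j) 0))
  (ℚᵘ.≃-sym (ℚᵘ.≃-trans (ℚ.toℚᵘ-homo-+ (+ j / 1) 1ℚ)
    (ℚᵘ.≃-trans (ℚᵘ.+-congˡ _ (ℚ.toℚᵘ-fromℚᵘ (mkℚᵘ (+ j) 0)))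
      (ℚᵘ.*≡* (cong (ℤ._* + 1) (trans (cong₂ ℤ._+_ (ℤ.*-identityʳ (+ j)) refl)
        (cong +_ (ℕ.+-comm j 1)))))))))

ι*u : ∀ c n → (+ (c ℕ.* suc n) / 1) ℚ.* (+ 1 / suc n) ≡ + c / 1
ι*u c n = ℚ.toℚᵘ-injective (ℚᵘ.≃-trans (ℚ.toℚᵘ-homo-* (+ (c ℕ.* suc n) / 1) (+ 1 / suc n))
  (ℚᵘ.≃-trans (ℚᵘ.*-cong (ℚ.toℚᵘ-fromℚᵘ (mkℚᵘ (+ (c ℕ.* suc n)) 0))
      (ℚ.toℚᵘ-fromℚᵘ (mkℚᵘ (+ 1) n)))
    (ℚᵘ.≃-trans (ℚᵘ.*≡* (trans (ℤ.*-identityʳ _) (trans (ℤ.*-identityʳ _)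
        (trans (ℤ.pos-* c (suc n)) (cong (λ t → + c ℤ.* + t) (sym (ℕ.+-identityʳ (suc n))))))))
      (ℚᵘ.≃-sym (ℚ.toℚᵘ-fromℚᵘ (mkℚᵘ (+ c) 0))))))

p<ι : ∀ p → p ℚ.< + suc ℤ.∣ ℚ.↥ p ∣ / 1
p<ι p@(mkℚ a d _) = ℚ.toℚᵘ-cancel-< (ℚᵘ.<-respʳ-≃
    (ℚᵘ.≃-sym (ℚ.toℚᵘ-fromℚᵘ (mkℚᵘ (+ suc ℤ.∣ a ∣) 0))) (ℚᵘ.*<* (lem a)))
  where
  lem : ∀ b → b ℤ.* + 1 ℤ.< + suc ℤ.∣ b ∣ ℤ.* + suc d
  lem (+ k) = subst₂ ℤ._<_ (sym (ℤ.*-identityʳ (+ k))) (ℤ.pos-* (suc k) (suc d))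
    (ℤ.+<+ (ℕ.<-≤-trans (ℕ.n<1+n k) (ℕ.m≤m*n (suc k) (suc d))))
  lem -[1+ k ] = ℤ.-<+

grid-≥0 : ∀ p u j → 0ℚ ℚ.≤ u → 0ℚ ℚ.≤ grid p u j
grid-≥0 p u zero 0≤u = ℚ.≤-refl
grid-≥0 p u (suc j) 0≤u with ((+ suc j / 1) ℚ.* u) ℚ.* ((+ suc j / 1) ℚ.* u) ℚ.≤? p
... | yes _ = 0≤* (0≤ι (suc j)) 0≤u
... | no  _ = grid-≥0 p u j 0≤u

grid-lower : ∀ p u j → 0ℚ ℚ.< grid p u j → grid p u j ℚ.* grid p u j ℚ.≤ p
grid-lower p u zero 0<0 = ⊥-elim (ℚ.<-irrefl refl 0<0)
grid-lower p u (suc j) s>0 with ((+ suc j / 1) ℚ.* u) ℚ.* ((+ suc j / 1) ℚ.* u) ℚ.≤? p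
... | yes s²≤p = s²≤p
... | no  _    = grid-lower p u j s>0

grid-upper : ∀ p u j → p ℚ.< ((+ suc j / 1) ℚ.* u) ℚ.* ((+ suc j / 1) ℚ.* u) →
             p ℚ.< (grid p u j ℚ.+ u) ℚ.* (grid p u j ℚ.+ u)
grid-upper p u zero p< = subst (λ t → p ℚ.< t ℚ.* t)
  (trans (ℚ.*-identityˡ u) (sym (ℚ.+-identityˡ u))) p<
grid-upper p u (suc j) p< with ((+ suc j / 1) ℚ.* u) ℚ.* ((+ suc j / 1) ℚ.* u) ℚ.≤? p
... | yes _    = subst (λ t → p ℚ.< t ℚ.* t)
  (trans (cong (ℚ._* u) (ι-suc (suc j))) (trans (ℚ.*-distribʳ-+ u (+ suc j / 1) 1ℚ)
    (cong ((+ suc j / 1) ℚ.* u ℚ.+_) (ℚ.*-identityˡ u)))) p<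
... | no s²≰p = grid-upper p u j (ℚ.≰⇒> s²≰p)

grid-bound : ∀ c n {p} → p ℚ.< + c / 1 → 1ℚ ℚ.≤ + c / 1 →
  p ℚ.< ((+ suc (c ℕ.* suc n) / 1) ℚ.* (+ 1 / suc n)) ℚ.* ((+ suc (c ℕ.* suc n) / 1) ℚ.* (+ 1 / suc n))
grid-bound c n p<ιc 1≤ιc = ℚ.<-≤-trans p<ιc (ℚ.≤-trans ιc≤ιc² (sq-mono (0≤ι c) ιc≤))
  where
  ιc≤ : + c / 1 ℚ.≤ (+ suc (c ℕ.* suc n) / 1) ℚ.* (+ 1 / suc n)
  ιc≤ = subst (ℚ._≤ (+ suc (c ℕ.* suc n) / 1) ℚ.* (+ 1 / suc n)) (ι*u c n)
    (ℚ.*-monoʳ-≤-nonNeg (+ 1 / suc n) {{ℚ.nonNegative (0≤u n)}}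
      (subst₂ ℚ._≤_ (ℚ.+-identityʳ (+ (c ℕ.* suc n) / 1)) (sym (ι-suc (c ℕ.* suc n)))
        (ℚ.+-monoʳ-≤ (+ (c ℕ.* suc n) / 1) (ℚ.<⇒≤ (ℚ.positive⁻¹ 1ℚ)))))
  ιc≤ιc² : + c / 1 ℚ.≤ (+ c / 1) ℚ.* (+ c / 1)
  ιc≤ιc² = subst (ℚ._≤ (+ c / 1) ℚ.* (+ c / 1)) (ℚ.*-identityʳ (+ c / 1))
    (ℚ.*-monoˡ-≤-nonNeg (+ c / 1) {{ℚ.nonNegative (0≤ι c)}} 1≤ιc)

1≤ι-suc : ∀ k → 1ℚ ℚ.≤ + suc k / 1
1≤ι-suc k = subst₂ ℚ._≤_ (ℚ.+-identityˡ 1ℚ) (sym (ι-suc k)) (ℚ.+-monoˡ-≤ 1ℚ (0≤ι k))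

√-approx-upper : ∀ p n → p ℚ.< (√-approx p n ℚ.+ + 1 / suc n) ℚ.* (√-approx p n ℚ.+ + 1 / suc n)
√-approx-upper p n = grid-upper p (+ 1 / suc n) (suc ℤ.∣ ℚ.↥ p ∣ ℕ.* suc n)
  (grid-bound (suc ℤ.∣ ℚ.↥ p ∣) n (p<ι p) (1≤ι-suc ℤ.∣ ℚ.↥ p ∣))

u≤ε : ∀ ε → 0ℚ ℚ.< ε → ∃[ N ] (∀ n → N ℕ.≤ n → + 1 / suc n ℚ.≤ ε)
u≤ε ε@(mkℚ (+ zero) d _) (ℚ.*<* (ℤ.+<+ ()))
u≤ε ε@(mkℚ -[1+ k ] d _) (ℚ.*<* ())
u≤ε ε@(mkℚ +[1+ k ] d _) _ = d , λ n d≤n → ℚ.toℚᵘ-cancel-≤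
  (ℚᵘ.≤-respˡ-≃ (ℚᵘ.≃-sym (ℚ.toℚᵘ-fromℚᵘ (mkℚᵘ (+ 1) n)))
    (ℚᵘ.*≤* (subst₂ ℤ._≤_ (sym (ℤ.*-identityˡ (+ suc d))) (ℤ.pos-* (suc k) (suc n))
      (ℤ.+≤+ (ℕ.≤-trans (ℕ.s≤s d≤n) (ℕ.m≤n*m (suc n) (suc k)))))))

root-gap : ∀ {a b r s u h ε} → 0ℚ ℚ.≤ s → 0ℚ ℚ.≤ u → u ℚ.≤ h → 0ℚ ℚ.< h → h ℚ.+ h ≡ ε →
  a ℚ.< (s ℚ.+ u) ℚ.* (s ℚ.+ u) → (0ℚ ℚ.< r → r ℚ.* r ℚ.≤ b) →
  b ℚ.- a ℚ.< h ℚ.* h → r ℚ.- s ℚ.< ε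
root-gap {a} {b} {r} {s} {u} {h} {ε} 0≤s 0≤u u≤h h>0 h+h≡ε a<t² r²≤b Δ<h² =
    ℚ.≰⇒> (λ ε≤ → ℚ.<-irrefl refl (ℚ.<-trans (h²<Δ ε≤) Δ<h²))
  where
  t : ℚ
  t = s ℚ.+ u
  0≤h : 0ℚ ℚ.≤ h
  0≤h = ℚ.<⇒≤ h>0
  0≤t : 0ℚ ℚ.≤ t
  0≤t = 0≤+ 0≤s 0≤u
  t+h≤r : ε ℚ.≤ r ℚ.- s → t ℚ.+ h ℚ.≤ r
  t+h≤r ε≤ = ℚ.≤-trans (ℚ.+-monoˡ-≤ h (ℚ.+-monoʳ-≤ s u≤h))
    (ℚ.≤-trans (ℚ.≤-reflexive (trans (ℚ.+-assoc s h h) (cong (s ℚ.+_) h+h≡ε)))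
      (subst (s ℚ.+ ε ℚ.≤_) (ring9 r s) (ℚ.+-monoʳ-≤ s ε≤)))
  r>0 : ε ℚ.≤ r ℚ.- s → 0ℚ ℚ.< r
  r>0 ε≤ = ℚ.<-≤-trans (subst (ℚ._< t ℚ.+ h) (ℚ.+-identityˡ 0ℚ) (ℚ.+-mono-≤-< 0≤t h>0)) (t+h≤r ε≤)
  a+h²<b : ε ℚ.≤ r ℚ.- s → a ℚ.+ h ℚ.* h ℚ.< b
  a+h²<b ε≤ = ℚ.<-≤-trans (ℚ.+-monoˡ-< (h ℚ.* h) a<t²)
    (ℚ.≤-trans (subst₂ ℚ._≤_ (ℚ.+-identityʳ (t ℚ.* t ℚ.+ h ℚ.* h)) (ring10 t h)
        (ℚ.+-monoʳ-≤ (t ℚ.* t ℚ.+ h ℚ.* h) (0≤+ (0≤* 0≤t 0≤h) (0≤* 0≤t 0≤h))))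
      (ℚ.≤-trans (sq-mono (0≤+ 0≤t 0≤h) (t+h≤r ε≤)) (r²≤b (r>0 ε≤))))
  h²<Δ : ε ℚ.≤ r ℚ.- s → h ℚ.* h ℚ.< b ℚ.- a
  h²<Δ ε≤ = subst (ℚ._< b ℚ.- a) (ring11 a (h ℚ.* h)) (ℚ.+-monoˡ-< (ℚ.- a) (a+h²<b ε≤))

√-approx-gap : ∀ p p′ n n′ {h ε} → + 1 / suc n′ ℚ.≤ h → 0ℚ ℚ.< h → h ℚ.+ h ≡ ε →
  ℚ.∣ p ℚ.- p′ ∣ ℚ.< h ℚ.* h → √-approx p n ℚ.- √-approx p′ n′ ℚ.< ε
√-approx-gap p p′ n n′ u≤h h>0 h+h≡ε close =
  root-gap (grid-≥0 p′ (+ 1 / suc n′) (suc ℤ.∣ ℚ.↥ p′ ∣ ℕ.* suc n′) (0≤u n′)) (0≤u n′) u≤h h>0 h+h≡ε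
    (√-approx-upper p′ n′)
    (grid-lower p (+ 1 / suc n) (suc ℤ.∣ ℚ.↥ p ∣ ℕ.* suc n))
    (ℚ.≤-<-trans (p≤∣p∣ (p ℚ.- p′)) close)

-- The n-th term s satisfies s² ≤ xₙ < (s + 1 / suc n)² when xₙ ≥ 0; √ x = 0 when x is negative.
√_ : ℝ → ℝ
(√ x) .seq n = √-approx (seq x n) n
(√ x) .cauchy ε ε>0 =
  let h , h>0 , h+h≡ε = halve ε ε>0
      h²>0 = subst (ℚ._< h ℚ.* h) (ℚ.*-zeroʳ h) (ℚ.*-monoʳ-<-pos h {{ℚ.positive h>0}} h>0)
      M , u≤h = u≤ε h h>0
      N , close = cauchy x (h ℚ.* h) h²>0
  in M ℕ.⊔ N , λ m n m≥ n≥ →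
    ∣∣-< (√-approx-gap (seq x m) (seq x n) m n (u≤h n (≤⊔ˡ M N n≥)) h>0 h+h≡ε
           (close m n (≤⊔ʳ M N m≥) (≤⊔ʳ M N n≥)))
      (subst (ℚ._< ε) (ring8 (√-approx (seq x m) m) (√-approx (seq x n) n))
        (√-approx-gap (seq x n) (seq x m) n m (u≤h m (≤⊔ˡ M N m≥)) h>0 h+h≡ε
          (close n m (≤⊔ʳ M N n≥) (≤⊔ʳ M N m≥))))

∑ : {A : Set} → List A → (A → ℝ) → ℝ
∑ xs g = foldr (λ x s → g x +ℝ s) 0ℝ xs

-- The value at [] is a convention; a graph with a root has a vertex, and in a regular tree of
-- degree at least 3 no tube around a nonempty finite set is empty.
mean : {A : Set} → List A → (A → ℝ) → ℝ
mean []          g = 0ℝ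
mean xs@(_ ∷ ys) g = fromℚ (+ 1 / suc (length ys)) *ℝ ∑ xs g

record Enumeration {A : Set} (P : A → Set) : Set where
  field
    elements : List A
    unique   : Unique elements
    members  : ∀ x → x ∈ elements ⇔ P x

open Enumeration public

data Walk {A : Set} (_~_ : Rel A 0ℓ) : ℕ → A → A → Set where
  stop : ∀ {x} → Walk _~_ zero x x
  step : ∀ {n x y z} → x ~ y → Walk _~_ n y z → Walk _~_ (suc n) x z

Distance : {A : Set} → Rel A 0ℓ → A → A → ℕ → Set
Distance _~_ x y n = Walk _~_ n x y × (∀ m → Walk _~_ m x y → n ℕ.≤ m)

-- Loops are edges with equal ends; multiple edges are distinct indices with the same ends.
record Graph : Set where
  field
    order : ℕ
    size  : ℕ
    ends  : Fin size → Fin order × Fin order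

module _ (G : Graph) where
  open Graph G

  Vertex : Set
  Vertex = Fin order

  -- An edge with a direction of traversal; in particular a loop gives two darts.
  Dart : Set
  Dart = Fin size × Bool

  source target : Dart → Vertex
  source (e , true)  = proj₁ (ends e)
  source (e , false) = proj₂ (ends e)
  target (e , true)  = proj₂ (ends e)
  target (e , false) = proj₁ (ends e)

  reverse : Dart → Dart
  reverse (e , b) = e , not b

  vertices : List Vertex
  vertices = allFin order

  darts : List Dart
  darts = cartesianProduct (allFin size) (true ∷ false ∷ [])

  degree : Vertex → ℕ
  degree v = length (filter (λ d → source d Fin.≟ v) darts)

  Regular : ℕ → Set
  Regular k = ∀ v → degree v ≡ k

  Adjacent : Rel Vertex 0ℓ
  Adjacent u v = ∃[ d ] source d ≡ u × target d ≡ v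

  -- The vertex set may be empty here, but an empty graph is bipartite.
  Connected : Set
  Connected = ∀ u v → Star Adjacent u v

  Bipartite : Set
  Bipartite = Σ[ colour ∈ (Vertex → Bool) ] (∀ d → colour (source d) ≢ colour (target d))

  norm₂ : (Vertex → ℝ) → ℝ
  norm₂ f = √ ∑ vertices (λ v → f v *ℝ f v)

  _≟ᵈ_ : DecidableEquality Dart
  _≟ᵈ_ = Product.≡-dec Fin._≟_ Bool._≟_

  module _ (root : Vertex) where

    -- Paths from the root are listed with their last step first.
    endpoint : List Dart → Vertex
    endpoint []      = root
    endpoint (d ∷ _) = target d

    NotReversal : Dart → List Dart → Set
    NotReversal d []      = ⊤
    NotReversal d (e ∷ _) = d ≢ reverse e

    NonBacktracking : List Dart → Set
    NonBacktracking []       = ⊤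
    NonBacktracking (d ∷ ds) = source d ≡ endpoint ds × NotReversal d ds × NonBacktracking ds

    -- The proof is irrelevant so that cover vertices with the same steps are equal.
    record CoverVertex : Set where
      constructor path
      field
        steps            : List Dart
        .nonBacktracking : NonBacktracking steps

    open CoverVertex public

    π : CoverVertex → Vertex
    π v = endpoint (steps v)

    _~_ : Rel CoverVertex 0ℓ
    u ~ v = ∃[ d ] (steps u ≡ d ∷ steps v ⊎ steps v ≡ d ∷ steps u)

    record FiniteSubgraph : Set where
      field
        vertexList : List CoverVertex
        edgeList   : List (CoverVertex × CoverVertex)
        isEdge     : ∀ {u v} → (u , v) ∈ edgeList → u ~ v × u ∈ vertexList × v ∈ vertexList

    open FiniteSubgraph public

    NonemptySubgraph : FiniteSubgraph → Set
    NonemptySubgraph X = ∃[ v ] v ∈ vertexList X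

    Joined : FiniteSubgraph → Rel CoverVertex 0ℓ
    Joined X u v = (u , v) ∈ edgeList X ⊎ (v , u) ∈ edgeList X

    ConnectedSubgraph : FiniteSubgraph → Set
    ConnectedSubgraph X = ∀ u v → u ∈ vertexList X → v ∈ vertexList X → Star (Joined X) u v

    InTube : FiniteSubgraph → ℕ → CoverVertex → Set
    InTube X r v = (∃[ x ] x ∈ vertexList X × Distance _~_ v x r)
                 × (∀ x k → x ∈ vertexList X → Distance _~_ v x k → r ℕ.≤ k)

    steps-injective : ∀ {u v : CoverVertex} → steps u ≡ steps v → u ≡ v
    steps-injective refl = refl

    _≟ᵛ_ : DecidableEquality CoverVertex
    u ≟ᵛ v = map′ steps-injective (cong steps) (List.≡-dec _≟ᵈ_ (steps u) (steps v))

    notReversal? : ∀ d ds → Dec (NotReversal d ds)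
    notReversal? d []      = yes tt
    notReversal? d (e ∷ _) = ¬? (d ≟ᵈ reverse e)

    nonBacktracking? : ∀ ds → Dec (NonBacktracking ds)
    nonBacktracking? []       = yes tt
    nonBacktracking? (d ∷ ds) =
      source d Fin.≟ endpoint ds ×-dec notReversal? d ds ×-dec nonBacktracking? ds

    ~-sym : ∀ u v → u ~ v → v ~ u
    ~-sym u v (d , inj₁ p) = d , inj₂ p
    ~-sym u v (d , inj₂ p) = d , inj₁ p

    extends? : ∀ (ds es : List Dart) → Dec (∃[ d ] ds ≡ d ∷ es)
    extends? []       es = no λ ()
    extends? (d ∷ ds) es = map′ (λ p → d , cong (d ∷_) p) (λ { (_ , refl) → refl }) (List.≡-dec _≟ᵈ_ ds es)

    _~?_ : Decidable _~_
    u ~? v = map′ (λ { (inj₁ (d , p)) → d , inj₁ p ; (inj₂ (d , p)) → d , inj₂ p })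
                  (λ { (d , inj₁ p) → inj₁ (d , p) ; (d , inj₂ p) → inj₂ (d , p) })
                  (extends? (steps u) (steps v) ⊎-dec extends? (steps v) (steps u))

    asVertex : List Dart → Maybe CoverVertex
    asVertex ds with nonBacktracking? ds
    ... | yes p = just (path ds p)
    ... | no  _ = nothing

    near : CoverVertex → List CoverVertex
    near u = mapMaybe asVertex (drop 1 (steps u) ∷ map (_∷ steps u) darts)

    ∈-darts : ∀ d → d ∈ darts
    ∈-darts (e , true)  = ∈-cartesianProduct⁺ (∈-allFin e) (here refl)
    ∈-darts (e , false) = ∈-cartesianProduct⁺ (∈-allFin e) (there (here refl))

    asVertex-steps : ∀ v → asVertex (steps v) ≡ just v
    asVertex-steps (path ds p) with nonBacktracking? ds
    ... | yes _ = refl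
    ... | no ¬p = ⊥-elim-irr (¬p p)
      where
      ⊥-elim-irr : {A : Set} → .⊥ → A
      ⊥-elim-irr ()

    near-complete : ∀ u v → u ~ v → v ∈ near u
    near-complete u v u~v = Any.mapMaybe⁺ asVertex _ (Any.map⁺ (Any.map just-v (candidate u~v)))
      where
      just-v : ∀ {ds} → steps v ≡ ds → MAny.Any (v ≡_) (asVertex ds)
      just-v refl = subst (MAny.Any (v ≡_)) (sym (asVertex-steps v)) (MAny.just refl)
      candidate : u ~ v → steps v ∈ drop 1 (steps u) ∷ map (_∷ steps u) darts
      candidate (d , inj₁ p) = here (sym (cong (drop 1) p))
      candidate (d , inj₂ p) = there (subst (_∈ map (_∷ steps u) darts) (sym p) (∈-map⁺ (_∷ steps u) (∈-darts d)))

    walk? : ∀ n u v → Dec (Walk _~_ n u v)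
    walk? zero    u v = map′ (λ { refl → stop }) (λ { stop → refl }) (u ≟ᵛ v)
    walk? (suc n) u v = map′ first-step any-step (Any.any? (λ y → u ~? y ×-dec walk? n y v) (near u))
      where
      first-step : Any (λ y → u ~ y × Walk _~_ n y v) (near u) → Walk _~_ (suc n) u v
      first-step a = let _ , _ , s , w = find a in step s w
      any-step : Walk _~_ (suc n) u v → Any (λ y → u ~ y × Walk _~_ n y v) (near u)
      any-step (step s w) = lose (near-complete u _ s) (s , w)

    distance? : ∀ u v n → Dec (Distance _~_ u v n)
    distance? u v n = walk? n u v ×-dec map′
      (λ none m w → ℕ.≮⇒≥ (λ m<n → none m<n w))
      (λ least {m} m<n w → ℕ.<⇒≱ m<n (least m w))
      (ℕ.allUpTo? (λ m → ¬? (walk? m u v)) n)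

    inTube? : ∀ X r v → Dec (InTube X r v)
    inTube? X r v =
        map′ attained attained⁻ (Any.any? (λ x → distance? v x r) (vertexList X))
      ×-dec
        map′ minimal minimal⁻ (All.all? (λ x → ℕ.allUpTo? (λ k → ¬? (distance? v x k)) r) (vertexList X))
      where
      attained : Any (λ x → Distance _~_ v x r) (vertexList X) →
                 ∃[ x ] x ∈ vertexList X × Distance _~_ v x r
      attained = find
      attained⁻ : (∃[ x ] x ∈ vertexList X × Distance _~_ v x r) →
                  Any (λ x → Distance _~_ v x r) (vertexList X)
      attained⁻ (_ , x∈X , δ) = lose x∈X δ
      minimal : All (λ x → ∀ {k} → k ℕ.< r → ¬ Distance _~_ v x k) (vertexList X) →
                ∀ x k → x ∈ vertexList X → Distance _~_ v x k → r ℕ.≤ k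
      minimal none x k x∈X δ = ℕ.≮⇒≥ (λ k<r → All.lookup none x∈X k<r δ)
      minimal⁻ : (∀ x k → x ∈ vertexList X → Distance _~_ v x k → r ℕ.≤ k) →
                 All (λ x → ∀ {k} → k ℕ.< r → ¬ Distance _~_ v x k) (vertexList X)
      minimal⁻ least = All.tabulate (λ {x} x∈X {k} k<r δ → ℕ.<⇒≱ k<r (least x k x∈X δ))

    reach : ℕ → CoverVertex → List CoverVertex
    reach zero    v = v ∷ []
    reach (suc n) v = concatMap near (reach n v)

    reach-complete : ∀ {n u v} → Walk _~_ n u v → u ∈ reach n v
    reach-complete stop = here refl
    reach-complete (step {x = u} {y = y} s w) =
      ∈-concatMap⁺ near (lose (reach-complete w) (near-complete y u (~-sym u y s)))

    candidates : FiniteSubgraph → ℕ → List CoverVertex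
    candidates X r = concatMap (reach r) (vertexList X)

    𝓣 : ∀ r X → Enumeration (InTube X r)
    𝓣 r X .elements = deduplicate _≟ᵛ_ (filter (inTube? X r) (candidates X r))
    𝓣 r X .unique   = deduplicate-! _≟ᵛ_ _
    𝓣 r X .members v = mk⇔
      (λ v∈ → proj₂ (∈-filter⁻ (inTube? X r) {xs = candidates X r} (∈-deduplicate⁻ _≟ᵛ_ _ v∈)))
      (λ { t@((x , x∈X , w , _) , _) → ∈-deduplicate⁺ _≟ᵛ_
             (∈-filter⁺ (inTube? X r) (∈-concatMap⁺ (reach r) (lose x∈X (reach-complete w))) t) })

{-# OPTIONS --safe #-}
module Submission where

-- A crude rate β suffices, so no spectral theory is needed.  For the non-backtracking shift on
-- darts every dart has q successors and q predecessors.  Let S be a set of darts.  Counting pairs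
-- shows that its successor set is at least as large as S, and that if two steps do not enlarge S
-- then S and its successor set are unions of full in-stars; connectedness then makes S everything
-- or G bipartite.  Hence for some M every dart reaches every dart in exactly M steps, and M steps
-- shrink the supremum norm of a function of mean zero by the factor 1 - q⁻ᴹ (Doeblin), which is at
-- most βᴹ for a rational β < 1.  The tube of radius r + 1 around X is in bijection with the
-- non-backtracking dart sequences of length r + 1 that start by leaving X, so its mean is an
-- average, over the darts leaving X, of r-step averages of the shift.  The real statement is the
-- termwise rational one, up to the error 1 / suc n in the n-th term of the square root.

open import Defs
open import Algebra.Bundles using (CommutativeRing)
open import Algebra.Structures using (IsCommutativeMonoid)
open import Data.Bool using (Bool; true; false; if_then_else_)
import Data.Bool.Properties as Bool
open import Data.Empty using (⊥-elim)
import Data.Fin.Properties as Fin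
open import Data.Integer as ℤ using (+_)
open import Data.List using (List; []; _∷_; _++_; length; map; concatMap; filter; deduplicate)
import Data.List.Extrema as Extrema
open import Data.List.Membership.Propositional using (_∈_; _∉_; lose; find)
open import Data.List.Membership.Propositional.Properties using (∈-map⁺; ∈-map⁻; ∈-concatMap⁺;
  ∈-concatMap⁻; ∈-filter⁺; ∈-filter⁻; ∈-allFin; ∈-cartesianProduct⁺; ∈-deduplicate⁺; ∈-deduplicate⁻)
open import Data.List.Membership.Propositional.Properties.WithK using (unique∧set⇒bag)
import Data.List.Properties as List
open import Data.List.Relation.Binary.BagAndSetEquality using (∼bag⇒↭)
open import Data.List.Relation.Binary.Permutation.Propositional as ↭ using (_↭_)
open import Data.List.Relation.Binary.Permutation.Propositional.Properties using (↭-length; ∈-resp-↭)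
open import Data.List.Relation.Unary.All as All using ([]; _∷_)
open import Data.List.Relation.Unary.AllPairs using ([]; _∷_)
open import Data.List.Relation.Unary.Any as Any using (Any; here; there)
open import Data.List.Relation.Unary.Unique.Propositional using (Unique)
import Data.List.Relation.Unary.Unique.Propositional.Properties as Unique
open import Data.List.Relation.Unary.Unique.DecPropositional.Properties using (deduplicate-!)
open import Data.Nat as ℕ using (ℕ; zero; suc; s≤s; z≤n; NonZero)
import Data.Nat.DivMod as ℕ
import Data.Nat.Properties as ℕ
open import Data.Product using (∃-syntax; _×_; _,_; proj₁; proj₂)
open import Data.Rational as ℚ using (ℚ; 0ℚ; 1ℚ; _/_; _+_; _*_; _-_; -_; _≤_; _<_; ∣_∣)
import Data.Rational.Properties as ℚ
open import Data.Sum using (_⊎_; inj₁; inj₂; [_,_]′)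
open import Data.Unit using (tt)
open import Function using (_∘_; mk⇔; Equivalence)
open import Level using (0ℓ)
open import Relation.Binary using (DecidableEquality)
open import Relation.Binary.Construct.Closure.ReflexiveTransitive using (Star; _◅_)
open import Relation.Binary.PropositionalEquality using (_≡_; _≢_; refl; sym; trans; cong; cong₂; subst;
  subst₂; module ≡-Reasoning)
open import Relation.Nullary using (Dec; yes; no; ¬_; ¬?; does; contradiction)
open import Relation.Nullary.Decidable using (_×-dec_; dec-true; dec-false; recompute; toWitnessFalse)
open import Relation.Nullary.Decidable.Core using (dec⇒maybe)
import Relation.Unary as U
open import Tactic.RingSolver using (solve-∀)
open import Tactic.RingSolver.Core.AlmostCommutativeRing using (AlmostCommutativeRing; fromCommutativeRing)
open import Algebra.Properties.CommutativeSemiring.Exp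
  (CommutativeRing.commutativeSemiring ℚ.+-*-commutativeRing) using (^-distrib-*)
open import Algebra.Properties.Semiring.Exp (CommutativeRing.semiring ℚ.+-*-commutativeRing) using (_^_; ^-homo-*)

-- Finite sums over lists

-- Bijections below become permutations of duplicate-free enumerations, along which lengths and sums
-- are carried over.
unique-set⇒↭ : {A : Set} {xs ys : List A} → Unique xs → Unique ys →
  (∀ {x} → x ∈ xs → x ∈ ys) → (∀ {x} → x ∈ ys → x ∈ xs) → xs ↭ ys
unique-set⇒↭ uxs uys to from = ∼bag⇒↭ (unique∧set⇒bag uxs uys (mk⇔ to from))

-- One abstract development serves both the counting of darts in ℕ and the averaging in ℚ.
module Sum {A : Set} {_∙_ : A → A → A} {e : A} (isCM : IsCommutativeMonoid _≡_ _∙_ e) where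
  open IsCommutativeMonoid isCM using (assoc; comm; identityˡ)

  sum : {X : Set} → List X → (X → A) → A
  sum []       g = e
  sum (x ∷ xs) g = g x ∙ sum xs g

  module _ {X : Set} where

    sum-cong-∈ : (xs : List X) {g h : X → A} → (∀ {x} → x ∈ xs → g x ≡ h x) → sum xs g ≡ sum xs h
    sum-cong-∈ []       eq = refl
    sum-cong-∈ (x ∷ xs) eq = cong₂ _∙_ (eq (here refl)) (sum-cong-∈ xs (eq ∘ there))

    sum-cong : (xs : List X) {g h : X → A} → (∀ x → g x ≡ h x) → sum xs g ≡ sum xs h
    sum-cong xs eq = sum-cong-∈ xs (λ {x} _ → eq x)

    sum-ε : (xs : List X) → sum xs (λ _ → e) ≡ e
    sum-ε []       = refl
    sum-ε (x ∷ xs) = trans (identityˡ _) (sum-ε xs)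

    sum-++ : ∀ (xs ys : List X) g → sum (xs ++ ys) g ≡ sum xs g ∙ sum ys g
    sum-++ []       ys g = sym (identityˡ _)
    sum-++ (x ∷ xs) ys g = trans (cong (g x ∙_) (sum-++ xs ys g)) (sym (assoc _ _ _))

    interchange : ∀ a b c d → (a ∙ b) ∙ (c ∙ d) ≡ (a ∙ c) ∙ (b ∙ d)
    interchange a b c d = begin
      (a ∙ b) ∙ (c ∙ d) ≡⟨ assoc a b _ ⟩
      a ∙ (b ∙ (c ∙ d)) ≡⟨ cong (a ∙_) (sym (assoc b c d)) ⟩
      a ∙ ((b ∙ c) ∙ d) ≡⟨ cong (λ t → a ∙ (t ∙ d)) (comm b c) ⟩
      a ∙ ((c ∙ b) ∙ d) ≡⟨ cong (a ∙_) (assoc c b d) ⟩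
      a ∙ (c ∙ (b ∙ d)) ≡⟨ sym (assoc a c _) ⟩
      (a ∙ c) ∙ (b ∙ d) ∎
      where open ≡-Reasoning

    sum-∙ : ∀ (xs : List X) g h → sum xs (λ x → g x ∙ h x) ≡ sum xs g ∙ sum xs h
    sum-∙ []       g h = sym (identityˡ e)
    sum-∙ (x ∷ xs) g h = trans (cong ((g x ∙ h x) ∙_) (sum-∙ xs g h)) (interchange _ _ _ _)

    sum-↭ : ∀ {xs ys : List X} g → xs ↭ ys → sum xs g ≡ sum ys g
    sum-↭ g ↭.refl       = refl
    sum-↭ g (↭.prep x p) = cong (g x ∙_) (sum-↭ g p)
    sum-↭ {ys = _ ∷ _ ∷ ys} g (↭.swap x y p) = trans (cong (λ t → g x ∙ (g y ∙ t)) (sum-↭ g p))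
      (trans (sym (assoc _ _ _)) (trans (cong (_∙ sum ys g) (comm _ _)) (assoc _ _ _)))
    sum-↭ g (↭.trans p p′) = trans (sum-↭ g p) (sum-↭ g p′)

    sum-filter : ∀ {P : U.Pred X 0ℓ} (P? : U.Decidable P) xs g →
      sum (filter P? xs) g ≡ sum xs (λ x → if does (P? x) then g x else e)
    sum-filter P? []       g = refl
    sum-filter P? (x ∷ xs) g with does (P? x)
    ... | true  = cong (g x ∙_) (sum-filter P? xs g)
    ... | false = trans (sum-filter P? xs g) (sym (identityˡ _))

  sum-map : ∀ {X Y : Set} (h : X → Y) xs g → sum (map h xs) g ≡ sum xs (g ∘ h)
  sum-map h []       g = refl
  sum-map h (x ∷ xs) g = cong (g (h x) ∙_) (sum-map h xs g)

  sum-concatMap : ∀ {X Y : Set} (h : X → List Y) xs g →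
    sum (concatMap h xs) g ≡ sum xs (λ x → sum (h x) g)
  sum-concatMap h []       g = refl
  sum-concatMap h (x ∷ xs) g =
    trans (sum-++ (h x) (concatMap h xs) g) (cong (sum (h x) g ∙_) (sum-concatMap h xs g))

  sum-swap : ∀ {X Y : Set} (xs : List X) (ys : List Y) (g : X → Y → A) →
    sum xs (λ x → sum ys (g x)) ≡ sum ys (λ y → sum xs (λ x → g x y))
  sum-swap []       ys g = sym (sum-ε ys)
  sum-swap (x ∷ xs) ys g =
    trans (cong (sum ys (g x) ∙_) (sum-swap xs ys g)) (sym (sum-∙ ys _ _))

  -- Double counting along a relation: both sides are the sum over all pairs in which unrelated
  -- pairs contribute `e`.
  sum-filter-swap : ∀ {X Y : Set} {R : X → Y → Set} (R? : ∀ x y → Dec (R x y)) xs ys (g : X → Y → A) →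
    sum xs (λ x → sum (filter (R? x) ys) (g x)) ≡
    sum ys (λ y → sum (filter (λ x → R? x y) xs) (λ x → g x y))
  sum-filter-swap R? xs ys g = begin
    sum xs (λ x → sum (filter (R? x) ys) (g x))
      ≡⟨ sum-cong xs (λ x → sum-filter (R? x) ys (g x)) ⟩
    sum xs (λ x → sum ys (λ y → if does (R? x y) then g x y else e))
      ≡⟨ sum-swap xs ys _ ⟩
    sum ys (λ y → sum xs (λ x → if does (R? x y) then g x y else e))
      ≡⟨ sum-cong ys (λ y → sym (sum-filter (λ x → R? x y) xs (λ x → g x y))) ⟩
    sum ys (λ y → sum (filter (λ x → R? x y) xs) (λ x → g x y)) ∎
    where open ≡-Reasoning

module Σℕ = Sum ℕ.+-0-isCommutativeMonoid

module _ {X : Set} where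

  sumℕ-const : (xs : List X) (c : ℕ) → Σℕ.sum xs (λ _ → c) ≡ length xs ℕ.* c
  sumℕ-const []       c = refl
  sumℕ-const (x ∷ xs) c = cong (c ℕ.+_) (sumℕ-const xs c)

  sumℕ-*ˡ : (xs : List X) (c : ℕ) (g : X → ℕ) → Σℕ.sum xs (λ x → c ℕ.* g x) ≡ c ℕ.* Σℕ.sum xs g
  sumℕ-*ˡ []       c g = sym (ℕ.*-zeroʳ c)
  sumℕ-*ˡ (x ∷ xs) c g = trans (cong (c ℕ.* g x ℕ.+_) (sumℕ-*ˡ xs c g)) (sym (ℕ.*-distribˡ-+ c (g x) _))

  sumℕ-mono : (xs : List X) {g h : X → ℕ} → (∀ x → g x ℕ.≤ h x) → Σℕ.sum xs g ℕ.≤ Σℕ.sum xs h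
  sumℕ-mono []       g≤h = z≤n
  sumℕ-mono (x ∷ xs) g≤h = ℕ.+-mono-≤ (g≤h x) (sumℕ-mono xs g≤h)

  sumℕ-∈ : {xs : List X} (g : X → ℕ) → ∀ {x} → x ∈ xs → g x ℕ.≤ Σℕ.sum xs g
  sumℕ-∈ g (here refl) = ℕ.m≤m+n _ _
  sumℕ-∈ g (there x∈)  = ℕ.≤-trans (sumℕ-∈ g x∈) (ℕ.m≤n+m _ _)

  -- The equality case of a double count: if the larger family has no larger total, no single term
  -- can fall short.
  sumℕ-tight : (xs : List X) {g h : X → ℕ} → (∀ x → g x ℕ.≤ h x) →
    Σℕ.sum xs h ℕ.≤ Σℕ.sum xs g → ∀ {x} → x ∈ xs → h x ℕ.≤ g x
  sumℕ-tight (x ∷ xs) {g} {h} g≤h h≤g (here refl) =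
    ℕ.+-cancelʳ-≤ (Σℕ.sum xs g) _ _ (ℕ.≤-trans (ℕ.+-monoʳ-≤ (h x) (sumℕ-mono xs g≤h)) h≤g)
  sumℕ-tight (x ∷ xs) {g} {h} g≤h h≤g (there y∈) =
    sumℕ-tight xs g≤h (ℕ.+-cancelˡ-≤ (h x) _ _ (ℕ.≤-trans h≤g (ℕ.+-monoˡ-≤ _ (g≤h x)))) y∈

-- Darts and the expansion of their successor sets

module Darts (G : Graph) where
  open Graph G

  infix 4 _↝_ _↝?_

  -- The second dart may follow the first in a non-backtracking path. A loop may follow itself, but
  -- not its own reversal.
  _↝_ : Dart G → Dart G → Set
  d ↝ e = source G e ≡ target G d × e ≢ reverse G d

  _↝?_ : ∀ d e → Dec (d ↝ e)
  d ↝? e = source G e Fin.≟ target G d ×-dec ¬? (_≟ᵈ_ G e (reverse G d))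

  dart∈ : ∀ d → d ∈ darts G
  dart∈ (e , true)  = ∈-cartesianProduct⁺ (∈-allFin e) (here refl)
  dart∈ (e , false) = ∈-cartesianProduct⁺ (∈-allFin e) (there (here refl))

  darts-unique : Unique (darts G)
  darts-unique = Unique.cartesianProduct⁺ (Unique.allFin⁺ size) (((λ ()) ∷ []) ∷ [] ∷ [])

  reverse² : ∀ d → reverse G (reverse G d) ≡ d
  reverse² (e , b) = cong (e ,_) (Bool.not-involutive b)

  reverse-injective : ∀ {d e} → reverse G d ≡ reverse G e → d ≡ e
  reverse-injective {d} {e} eq = trans (sym (reverse² d)) (trans (cong (reverse G) eq) (reverse² e))

  source-reverse : ∀ d → source G (reverse G d) ≡ target G d
  source-reverse (e , true)  = refl
  source-reverse (e , false) = refl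

  target-reverse : ∀ d → target G (reverse G d) ≡ source G d
  target-reverse (e , true)  = refl
  target-reverse (e , false) = refl

  ↝-reverse : ∀ {d e} → d ↝ e → reverse G e ↝ reverse G d
  ↝-reverse {d} {e} (s , ne) =
    trans (source-reverse d) (trans (sym s) (sym (target-reverse e))) ,
    λ eq → ne (sym (trans eq (reverse² e)))

  succ pred : Dart G → List (Dart G)
  succ d = filter (d ↝?_) (darts G)
  pred e = filter (_↝? e) (darts G)

  ∈-succ : ∀ {d e} → d ↝ e → e ∈ succ d
  ∈-succ {d} {e} = ∈-filter⁺ (d ↝?_) (dart∈ e)

  ∈-succ⁻ : ∀ {d e} → e ∈ succ d → d ↝ e
  ∈-succ⁻ {d} e∈ = proj₂ (∈-filter⁻ (d ↝?_) {xs = darts G} e∈)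

  succ-unique : ∀ d → Unique (succ d)
  succ-unique d = Unique.filter⁺ (d ↝?_) darts-unique

  incoming outgoing : Vertex G → List (Dart G)
  incoming v = filter (λ d → target G d Fin.≟ v) (darts G)
  outgoing v = filter (λ d → source G d Fin.≟ v) (darts G)

  outgoing-unique : ∀ v → Unique (outgoing v)
  outgoing-unique v = Unique.filter⁺ (λ d → source G d Fin.≟ v) darts-unique

  -- Among the darts leaving the end of `d` only its reversal is excluded as a successor, so degree
  -- `suc q` leaves `q` successors.
  outgoing↭succ : ∀ d → outgoing (target G d) ↭ reverse G d ∷ succ d
  outgoing↭succ d = unique-set⇒↭ (outgoing-unique _)
    (All.tabulate (λ e∈ eq → proj₂ (∈-succ⁻ e∈) (sym eq)) ∷ succ-unique d) to from
    where
    to : ∀ {e} → e ∈ outgoing (target G d) → e ∈ reverse G d ∷ succ d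
    to {e} e∈ with _≟ᵈ_ G e (reverse G d)
    ... | yes eq = here eq
    ... | no  ne = there (∈-succ
      (proj₂ (∈-filter⁻ (λ d′ → source G d′ Fin.≟ target G d) {xs = darts G} e∈) , ne))
    from : ∀ {e} → e ∈ reverse G d ∷ succ d → e ∈ outgoing (target G d)
    from (here refl) = ∈-filter⁺ (λ d′ → source G d′ Fin.≟ target G d) (dart∈ _) (source-reverse d)
    from (there e∈)  = ∈-filter⁺ (λ d′ → source G d′ Fin.≟ target G d) (dart∈ _) (proj₁ (∈-succ⁻ e∈))

  incoming↭ : ∀ v → incoming v ↭ map (reverse G) (outgoing v)
  incoming↭ v = unique-set⇒↭ (Unique.filter⁺ (λ d → target G d Fin.≟ v) darts-unique)
    (Unique.map⁺ reverse-injective (outgoing-unique v)) to from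
    where
    to : ∀ {e} → e ∈ incoming v → e ∈ map (reverse G) (outgoing v)
    to {e} e∈ = subst (_∈ map (reverse G) (outgoing v)) (reverse² e)
      (∈-map⁺ (reverse G) (∈-filter⁺ (λ d → source G d Fin.≟ v) (dart∈ (reverse G e))
        (trans (source-reverse e) (proj₂ (∈-filter⁻ (λ d → target G d Fin.≟ v) {xs = darts G} e∈)))))
    from : ∀ {e} → e ∈ map (reverse G) (outgoing v) → e ∈ incoming v
    from e∈ with ∈-map⁻ (reverse G) e∈
    ... | d , d∈ , refl = ∈-filter⁺ (λ d′ → target G d′ Fin.≟ v) (dart∈ _)
      (trans (target-reverse d) (proj₂ (∈-filter⁻ (λ d′ → source G d′ Fin.≟ v) {xs = darts G} d∈)))

  -- Reversal turns predecessors into successors, so predecessors are counted by counting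
  -- successors.
  pred↭ : ∀ e → pred e ↭ map (reverse G) (succ (reverse G e))
  pred↭ e = unique-set⇒↭ (Unique.filter⁺ (_↝? e) darts-unique)
    (Unique.map⁺ reverse-injective (succ-unique (reverse G e))) to from
    where
    to : ∀ {d} → d ∈ pred e → d ∈ map (reverse G) (succ (reverse G e))
    to {d} d∈ = subst (_∈ map (reverse G) (succ (reverse G e))) (reverse² d)
      (∈-map⁺ (reverse G) (∈-succ (↝-reverse (proj₂ (∈-filter⁻ (_↝? e) {xs = darts G} d∈)))))
    from : ∀ {d} → d ∈ map (reverse G) (succ (reverse G e)) → d ∈ pred e
    from d∈ with ∈-map⁻ (reverse G) d∈
    ... | c , c∈ , refl = ∈-filter⁺ (_↝? e) (dart∈ _)
      (subst (reverse G c ↝_) (reverse² e) (↝-reverse (∈-succ⁻ c∈)))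

  image : List (Dart G) → List (Dart G)
  image = concatMap succ

  ∈-image : ∀ {S d e} → d ∈ S → d ↝ e → e ∈ image S
  ∈-image d∈S d↝e = ∈-concatMap⁺ succ (lose d∈S (∈-succ d↝e))

  ∈-image⁻ : ∀ S {e} → e ∈ image S → ∃[ d ] d ∈ S × d ↝ e
  ∈-image⁻ S e∈ with find (∈-concatMap⁻ succ {xs = S} e∈)
  ... | d , d∈S , e∈d = d , d∈S , ∈-succ⁻ e∈d

  Full : List (Dart G) → Set
  Full S = ∀ e → e ∈ S

  open import Data.List.Membership.DecPropositional (_≟ᵈ_ G) using (_∈?_)

  χ : List (Dart G) → Dart G → ℕ
  χ S d = if does (d ∈? S) then 1 else 0

  χ-∈ : ∀ S {d} → d ∈ S → χ S d ≡ 1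
  χ-∈ S {d} d∈S = cong (if_then 1 else 0) (dec-true (d ∈? S) d∈S)

  χ-∉ : ∀ S {d} → ¬ d ∈ S → χ S d ≡ 0
  χ-∉ S {d} d∉S = cong (if_then 1 else 0) (dec-false (d ∈? S) d∉S)

  χ≤1 : ∀ S d → χ S d ℕ.≤ 1
  χ≤1 S d with does (d ∈? S)
  ... | true  = s≤s z≤n
  ... | false = z≤n

  -- Lists stand for sets, and `image` repeats entries; hence the size counts the darts that occur
  -- and not the entries.
  # : List (Dart G) → ℕ
  # S = Σℕ.sum (darts G) (χ S)

  #≤ : ∀ S → # S ℕ.≤ length (darts G)
  #≤ S = ℕ.≤-trans (sumℕ-mono (darts G) (χ≤1 S))
    (ℕ.≤-reflexive (trans (sumℕ-const (darts G) 1) (ℕ.*-identityʳ _)))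

  module Reg {q : ℕ} (reg : Regular G (suc q)) where

    length-succ : ∀ d → length (succ d) ≡ q
    length-succ d = ℕ.suc-injective (trans (sym (↭-length (outgoing↭succ d))) (reg (target G d)))

    length-pred : ∀ e → length (pred e) ≡ q
    length-pred e = trans (↭-length (pred↭ e))
      (trans (List.length-map (reverse G) (succ (reverse G e))) (length-succ (reverse G e)))

    length-incoming : ∀ v → length (incoming v) ≡ suc q
    length-incoming v = trans (↭-length (incoming↭ v))
      (trans (List.length-map (reverse G) (outgoing v)) (reg v))

    pred-count : List (Dart G) → Dart G → ℕ
    pred-count S e = Σℕ.sum (pred e) (χ S)

    -- The pairs `d ↝ e` with `d` in `S` are grouped by `e` on the left; grouped by `d`, each member
    -- of `S` contributes `q`.
    pred-count-sum : ∀ S → Σℕ.sum (darts G) (pred-count S) ≡ q ℕ.* # S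
    pred-count-sum S = begin
      Σℕ.sum (darts G) (λ e → Σℕ.sum (pred e) (χ S))
        ≡⟨ sym (Σℕ.sum-filter-swap _↝?_ (darts G) (darts G) (λ d _ → χ S d)) ⟩
      Σℕ.sum (darts G) (λ d → Σℕ.sum (succ d) (λ _ → χ S d))
        ≡⟨ Σℕ.sum-cong (darts G) (λ d → trans (sumℕ-const (succ d) (χ S d)) (cong (ℕ._* χ S d) (length-succ d))) ⟩
      Σℕ.sum (darts G) (λ d → q ℕ.* χ S d)
        ≡⟨ sumℕ-*ˡ (darts G) q (χ S) ⟩
      q ℕ.* # S ∎
      where open ≡-Reasoning

    pred-count≤ : ∀ S e → pred-count S e ℕ.≤ q ℕ.* χ (image S) e
    pred-count≤ S e with e ∈? image S
    ... | yes e∈ = ℕ.≤-trans (sumℕ-mono (pred e) (χ≤1 S))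
      (ℕ.≤-reflexive (trans (sumℕ-const (pred e) 1) (cong (ℕ._* 1) (length-pred e))))
    ... | no e∉ = ℕ.≤-trans (ℕ.≤-reflexive (trans (Σℕ.sum-cong-∈ (pred e) none) (Σℕ.sum-ε (pred e)))) z≤n
      where
      none : ∀ {d} → d ∈ pred e → χ S d ≡ 0
      none d∈ = χ-∉ S (λ d∈S → e∉ (∈-image d∈S (proj₂ (∈-filter⁻ (_↝? e) {xs = darts G} d∈))))

    module _ .{{_ : ℕ.NonZero q}} where

      -- There are `q * # S` pairs `d ↝ e` with `d` in `S`; every dart of the image has `q`
      -- predecessors in all, so there are at most `q * # (image S)`.
      #≤#-image : ∀ S → # S ℕ.≤ # (image S)
      #≤#-image S = ℕ.*-cancelˡ-≤ q (subst₂ ℕ._≤_ (pred-count-sum S) (sumℕ-*ˡ (darts G) q (χ (image S)))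
        (sumℕ-mono (darts G) (pred-count≤ S)))

      -- Equality in the double count behind #≤#-image forces every predecessor of image S into S.
      pred⊆ : ∀ S → # (image S) ℕ.≤ # S → ∀ {d d′ e} → d ∈ S → d ↝ e → d′ ↝ e → d′ ∈ S
      pred⊆ S small {d} {d′} {e} d∈S d↝e d′↝e with d′ ∈? S
      ... | yes p = p
      ... | no d′∉S = contradiction
        (ℕ.≤-trans
          (sumℕ-tight (pred e) (χ≤1 S) all-in (∈-filter⁺ (_↝? e) (dart∈ d′) d′↝e))
          (ℕ.≤-reflexive (χ-∉ S d′∉S)))
        λ ()
        where
        tight : q ℕ.* χ (image S) e ℕ.≤ pred-count S e
        tight = sumℕ-tight (darts G) (pred-count≤ S)
          (ℕ.≤-trans (ℕ.≤-reflexive (sumℕ-*ˡ (darts G) q (χ (image S))))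
            (ℕ.≤-trans (ℕ.*-monoʳ-≤ q small) (ℕ.≤-reflexive (sym (pred-count-sum S))))) (dart∈ e)
        all-in : Σℕ.sum (pred e) (λ _ → 1) ℕ.≤ Σℕ.sum (pred e) (χ S)
        all-in = ℕ.≤-trans
          (ℕ.≤-reflexive (trans (sumℕ-const (pred e) 1) (trans (cong (ℕ._* 1) (length-pred e))
            (cong (q ℕ.*_) (sym (χ-∈ (image S) (∈-image d∈S d↝e))))))) tight

    module _ (2≤q : 2 ℕ.≤ q) where

      two-succ : ∀ d → ∃[ e₁ ] ∃[ e₂ ] d ↝ e₁ × d ↝ e₂ × e₁ ≢ e₂
      two-succ d with succ d | length-succ d | succ-unique d | (λ {e} → ∈-succ⁻ {d} {e})
      ... | []            | refl | _ | _ = contradiction 2≤q λ ()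
      ... | e₁ ∷ []       | refl | _ | _ = contradiction 2≤q λ { (s≤s ()) }
      ... | e₁ ∷ e₂ ∷ _   | _    | (ne ∷ _) ∷ _ | ∈⁻ = e₁ , e₂ , ∈⁻ (here refl) , ∈⁻ (there (here refl)) , ne

      instance
        q-nonZero : ℕ.NonZero q
        q-nonZero = ℕ.>-nonZero (ℕ.≤-trans (s≤s z≤n) 2≤q)

      -- Two darts ending at one vertex share a successor: of two successors of `d`, at most one is
      -- the reversal of `d′`. Through the shared one `pred⊆` brings `d′` into `S`.
      in-star : ∀ S → # (image S) ℕ.≤ # S → ∀ {d d′} → d ∈ S → target G d′ ≡ target G d → d′ ∈ S
      in-star S small {d} {d′} d∈S t with two-succ d
      ... | e₁ , e₂ , d↝e₁ , d↝e₂ , e₁≢e₂ with _≟ᵈ_ G e₁ (reverse G d′)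
      ... | no  ne   = pred⊆ S small d∈S d↝e₁ (trans (proj₁ d↝e₁) (sym t) , ne)
      ... | yes refl = pred⊆ S small d∈S d↝e₂ (trans (proj₁ d↝e₂) (sym t) , e₁≢e₂ ∘ sym)

      hits? : ∀ S v → Dec (Any (λ d → target G d ≡ v) S)
      hits? S v = Any.any? (λ d → target G d Fin.≟ v) S

      module Stagnant (connected : Connected G) (nonbip : ¬ Bipartite G)
                      (S : List (Dart G)) {d₀ : Dart G} (d₀∈S : d₀ ∈ S)
                      (stagnant : # (image (image S)) ℕ.≤ # S) where

        -- Once `S` and its image are known to be unions of full in-stars, these vertex sets
        -- determine them.
        U U′ : Vertex G → Set
        U  v = Any (λ d → target G d ≡ v) S
        U′ v = Any (λ d → target G d ≡ v) (image S)

        -- The chain `# S ≤ # (image S) ≤ # (image (image S)) ≤ #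
        -- S` collapses to equalities, so `in-star` applies to `S` here and to its image in `star′`.
        star : ∀ {d d′} → d ∈ S → target G d′ ≡ target G d → d′ ∈ S
        star = in-star S (ℕ.≤-trans (#≤#-image (image S)) stagnant)

        star′ : ∀ {d d′} → d ∈ image S → target G d′ ≡ target G d → d′ ∈ image S
        star′ = in-star (image S) (ℕ.≤-trans stagnant (#≤#-image S))

        -- Some `d` in `S` ends where `e` starts, and `e` succeeds it unless it is the reversal of
        -- `d`. In that case another dart of the same in-star precedes `e`: the reversal of a
        -- successor of `d`, which `star` puts into `S`.
        U-source : ∀ e → U (source G e) → e ∈ image S
        U-source e u with find u
        ... | d , d∈S , t with _≟ᵈ_ G e (reverse G d)
        ... | no ne = ∈-image d∈S (sym t , ne)
        ... | yes refl with two-succ d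
        ... | e₁ , _ , (s , ne) , _ = ∈-image {d = reverse G e₁}
          (star d∈S (trans (target-reverse e₁) s))
          (trans (source-reverse d) (trans (sym s) (sym (target-reverse e₁))) ,
           λ eq → ne (sym (trans eq (reverse² e₁))))

        forth : ∀ e → U (source G e) → U′ (target G e)
        forth e u = lose (U-source e u) refl

        -- By `star′` the dart `e` itself is in the image, and its predecessor in `S` ends at the
        -- source of `e`.
        back : ∀ e → U′ (target G e) → U (source G e)
        back e u′ with find u′
        ... | d , d∈ , t with ∈-image⁻ S (star′ {d′ = e} d∈ (sym t))
        ... | c , c∈S , s , _ = lose c∈S (sym s)

        back-reverse : ∀ e → U′ (source G e) → U (target G e)
        back-reverse e u′ = subst U (source-reverse e) (back (reverse G e) (subst U′ (sym (target-reverse e)) u′))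

        spread : ∀ {P : Vertex G → Set} → (∀ e → P (source G e) → P (target G e)) →
                 ∀ {u v} → Star (Adjacent G) u v → P u → P v
        spread closed Star.ε p = p
        spread closed ((e , refl , refl) ◅ w) p = spread closed w (closed e p)

        -- Every dart leads from `U` into `U′` and from `U′` into `U`, so no walk from the end of
        -- `d₀` leaves their union.
        cover : ∀ v → U v ⊎ U′ v
        cover v = spread (λ e → [ inj₂ ∘ forth e , inj₁ ∘ back-reverse e ]′)
          (connected (target G d₀) v) (inj₁ (lose d₀∈S refl))

        -- Membership in both sets passes along every dart, so by connectedness all vertices lie in
        -- `U`; then `star` puts every dart into `S`.
        meet⇒full : ∀ {v} → U v → U′ v → Full S
        meet⇒full {v} u u′ e with find (proj₁ (spread {λ v → U v × U′ v}
          (λ e′ → λ { (p , p′) → back-reverse e′ p′ , forth e′ p }) (connected v (target G e)) (u , u′)))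
        ... | d , d∈S , t = star d∈S (sym t)

        -- If `U` and `U′` are disjoint, they are the two classes of a bipartition, and membership
        -- in `U` is a proper colouring.
        colour : Vertex G → Bool
        colour v = does (hits? S v)

        colour-U : ∀ {v} → colour v ≡ true → U v
        colour-U {v} eq with hits? S v
        ... | yes u = u

        colour-¬U : ∀ {v} → colour v ≡ false → ¬ U v
        colour-¬U {v} eq with hits? S v
        ... | no ¬u = ¬u

        -- If both ends lie in `U`, the target is also in `U′` by `forth`, and the sets meet. If
        -- neither does, `cover` puts the target into `U′` and `back` the source into `U`, a
        -- contradiction.
        monochromatic⇒full : ∀ e → colour (source G e) ≡ colour (target G e) → Full S
        monochromatic⇒full e same with colour (source G e) in eq
        ... | true  = meet⇒full (colour-U (sym same)) (forth e (colour-U eq))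
        ... | false = ⊥-elim ([ ¬u , ¬u′ ]′ (cover (target G e)))
          where
          ¬u : ¬ U (target G e)
          ¬u = colour-¬U (sym same)
          ¬u′ : ¬ U′ (target G e)
          ¬u′ = colour-¬U eq ∘ back e

        full : Full S
        full with Any.any? (λ e → colour (source G e) Bool.≟ colour (target G e)) (darts G)
        ... | yes some with find some
        ...   | e , _ , same = monochromatic⇒full e same
        full | no none = contradiction (colour , λ e same → none (lose (dart∈ e) same)) nonbip

      reach-from : ℕ → List (Dart G) → List (Dart G)
      reach-from zero    S = S
      reach-from (suc k) S = image (reach-from k S)

      has-pred : ∀ e → ∃[ d ] d ↝ e
      has-pred e with two-succ (reverse G e)
      ... | c , _ , c↝ , _ = reverse G c , subst (reverse G c ↝_) (reverse² e) (↝-reverse c↝)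

      Full-image : ∀ {S} → Full S → Full (image S)
      Full-image full e with has-pred e
      ... | d , d↝e = ∈-image (full d) d↝e

      image-nonempty : ∀ {S d} → d ∈ S → ∃[ e ] e ∈ image S
      image-nonempty {d = d} d∈S with two-succ d
      ... | e , _ , d↝e , _ = e , ∈-image d∈S d↝e

      reach-nonempty : ∀ k {S d} → d ∈ S → ∃[ e ] e ∈ reach-from k S
      reach-nonempty zero    d∈S = _ , d∈S
      reach-nonempty (suc k) d∈S = image-nonempty (proj₂ (reach-nonempty k d∈S))

      module _ (connected : Connected G) (nonbip : ¬ Bipartite G) where

        -- Two steps either enlarge the set or, by `Stagnant.full`, show that it was full already;
        -- fullness persists because every dart has a predecessor.
        growth : ∀ j {S d} → d ∈ S → Full (reach-from (j ℕ.* 2) S) ⊎ suc j ℕ.≤ # (reach-from (j ℕ.* 2) S)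
        growth zero {S} d∈S = inj₂ (ℕ.≤-trans (ℕ.≤-reflexive (sym (χ-∈ S d∈S))) (sumℕ-∈ (χ S) (dart∈ _)))
        growth (suc j) {S} d∈S with growth j d∈S
        ... | inj₁ full = inj₁ (Full-image (Full-image full))
        ... | inj₂ j<# with # (reach-from (j ℕ.* 2) S) ℕ.<? # (reach-from (suc j ℕ.* 2) S)
        ...   | yes lt = inj₂ (ℕ.≤-trans (s≤s j<#) lt)
        ...   | no ≮ = inj₁ (Full-image (Full-image
          (Stagnant.full connected nonbip _ (proj₂ (reach-nonempty (j ℕ.* 2) d∈S)) (ℕ.≮⇒≥ ≮))))

        -- With `j` the number of darts, `growth` leaves only fullness, since no set is larger than
        -- that. The further step makes the time nonzero by its form, as division by it requires.
        mixing-time : ℕ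
        mixing-time = suc (length (darts G) ℕ.* 2)

        reach-full : ∀ d → Full (reach-from mixing-time (d ∷ []))
        reach-full d with growth (length (darts G)) {d ∷ []} (here refl)
        ... | inj₁ full = Full-image full
        ... | inj₂ big  =
          contradiction (ℕ.≤-trans big (#≤ (reach-from (length (darts G) ℕ.* 2) (d ∷ [])))) ℕ.1+n≰n

-- Powers of rationals and the choice of the rate

ℚ-ring : AlmostCommutativeRing 0ℓ 0ℓ
ℚ-ring = fromCommutativeRing ℚ.+-*-commutativeRing (λ p → dec⇒maybe (0ℚ ℚ.≟ p))

ι : ℕ → ℚ
ι n = + n / 1

-- Reduces an inequality to a ring identity by exhibiting the difference as a visibly nonnegative
-- `r`.
≤-by : ∀ {p q} r → 0ℚ ≤ r → p + r ≡ q → p ≤ q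
≤-by {p} r 0≤r refl = subst (_≤ p + r) (ℚ.+-identityʳ p) (ℚ.+-monoʳ-≤ p 0≤r)

0≤-diff : ∀ {p q} → p ≤ q → 0ℚ ≤ q - p
0≤-diff {p} {q} p≤q = subst (_≤ q - p) (ℚ.+-inverseʳ p) (ℚ.+-monoˡ-≤ (- p) p≤q)

*-mono-≤ˡ : ∀ {a p q} → 0ℚ ≤ a → p ≤ q → a * p ≤ a * q
*-mono-≤ˡ {a} 0≤a = ℚ.*-monoˡ-≤-nonNeg a {{ℚ.nonNegative 0≤a}}

*-mono-≤ʳ : ∀ {a p q} → 0ℚ ≤ a → p ≤ q → p * a ≤ q * a
*-mono-≤ʳ {a} 0≤a = ℚ.*-monoʳ-≤-nonNeg a {{ℚ.nonNegative 0≤a}}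

∣∣-≤ : ∀ {p e} → p ≤ e → - p ≤ e → ∣ p ∣ ≤ e
∣∣-≤ {p} {e} p≤e -p≤e with ℚ.∣p∣≡p∨∣p∣≡-p p
... | inj₁ eq = subst (_≤ e) (sym eq) p≤e
... | inj₂ eq = subst (_≤ e) (sym eq) -p≤e

-p≤∣p∣ : ∀ p → - p ≤ ∣ p ∣
-p≤∣p∣ p = subst (- p ≤_) (ℚ.∣-p∣≡∣p∣ p) (p≤∣p∣ (- p))

0≤1 : 0ℚ ≤ 1ℚ
0≤1 = ℚ.<⇒≤ (ℚ.positive⁻¹ 1ℚ)

0≤^ : ∀ {p} n → 0ℚ ≤ p → 0ℚ ≤ p ^ n
0≤^ zero    0≤p = 0≤1
0≤^ (suc n) 0≤p = 0≤* 0≤p (0≤^ n 0≤p)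

1≤^ : ∀ {p} n → 1ℚ ≤ p → 1ℚ ≤ p ^ n
1≤^ zero    1≤p = ℚ.≤-refl
1≤^ {p} (suc n) 1≤p = ℚ.≤-trans 1≤p
  (subst (_≤ p * p ^ n) (ℚ.*-identityʳ p) (*-mono-≤ˡ (ℚ.≤-trans 0≤1 1≤p) (1≤^ n 1≤p)))

^-mono-≤ : ∀ {p q} n → 0ℚ ≤ p → p ≤ q → p ^ n ≤ q ^ n
^-mono-≤ zero    0≤p p≤q = ℚ.≤-refl
^-mono-≤ (suc n) 0≤p p≤q = ℚ.≤-trans (*-mono-≤ˡ 0≤p (^-mono-≤ n 0≤p p≤q))
  (*-mono-≤ʳ (0≤^ n (ℚ.≤-trans 0≤p p≤q)) p≤q)

1^ : ∀ n → 1ℚ ^ n ≡ 1ℚ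
1^ zero    = refl
1^ (suc n) = trans (ℚ.*-identityˡ _) (1^ n)

^≤1 : ∀ {p} n → 0ℚ ≤ p → p ≤ 1ℚ → p ^ n ≤ 1ℚ
^≤1 {p} n 0≤p p≤1 = subst (p ^ n ≤_) (1^ n) (^-mono-≤ n 0≤p p≤1)

^-antitone : ∀ {p m n} → 0ℚ ≤ p → p ≤ 1ℚ → m ℕ.≤ n → p ^ n ≤ p ^ m
^-antitone {p} {n = n} 0≤p p≤1 z≤n = ^≤1 n 0≤p p≤1
^-antitone 0≤p p≤1 (s≤s m≤n) = *-mono-≤ˡ 0≤p (^-antitone 0≤p p≤1 m≤n)

bernoulli : ∀ n {δ} → 0ℚ ≤ δ → δ ≤ 1ℚ → 1ℚ - ι n * δ ≤ (1ℚ - δ) ^ n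
bernoulli zero    {δ} 0≤δ δ≤1 = ℚ.≤-reflexive (lemma δ)
  where
  lemma : ∀ δ → 1ℚ - 0ℚ * δ ≡ 1ℚ
  lemma = solve-∀ ℚ-ring
bernoulli (suc n) {δ} 0≤δ δ≤1 = ℚ.≤-trans
  (≤-by (ι n * (δ * δ)) (0≤* (0≤ι n) (0≤* 0≤δ 0≤δ))
    (trans (cong (λ t → 1ℚ - t * δ + ι n * (δ * δ)) (ι-suc n)) (lemma δ (ι n))))
  (*-mono-≤ˡ (0≤-diff δ≤1) (bernoulli n 0≤δ δ≤1))
  where
  lemma : ∀ a m → 1ℚ - (m + 1ℚ) * a + m * (a * a) ≡ (1ℚ - a) * (1ℚ - m * a)
  lemma = solve-∀ ℚ-ring

-- `¾` exceeds `1 / √2`, so it bounds `q^(-1/2)` for all `q ≥ 2`; a rate of at least `¾` has its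
-- inverse bounded by `4/3`.
¾ 4/3 : ℚ
¾ = + 3 / 4
4/3 = + 4 / 3

0≤¾ : 0ℚ ≤ ¾
0≤¾ = ℚ.nonNegative⁻¹ ¾

-- `A` will be `q ^ M`. The field `decay` is `1 - 1 / A ≤ rate ^ M` without division: the
-- contraction over one block is majorised by `M` steps at this rate.
record Rate (A : ℚ) (M : ℕ) : Set where
  field
    gap   : ℚ
    0<gap : 0ℚ < gap

  rate : ℚ
  rate = 1ℚ - gap

  field
    ¾≤rate : ¾ ≤ rate
    decay  : A - 1ℚ ≤ A * rate ^ M

  0≤rate : 0ℚ ≤ rate
  0≤rate = ℚ.≤-trans 0≤¾ ¾≤rate

  rate≤1 : rate ≤ 1ℚ
  rate≤1 = ≤-by gap (ℚ.<⇒≤ 0<gap) (lemma gap)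
    where
    lemma : ∀ a → 1ℚ - a + a ≡ 1ℚ
    lemma = solve-∀ ℚ-ring

  -- `rate ^ s` is at least `¾ ^ M`, so `4/3 ^ M` makes up for an incomplete block of `s` steps, in
  -- which no contraction is claimed.
  rate-absorbs : ∀ {s} → s ℕ.≤ M → 1ℚ ≤ 4/3 ^ M * rate ^ s
  rate-absorbs {s} s≤M = ℚ.≤-trans
    (ℚ.≤-reflexive (trans (sym (1^ M)) (^-distrib-* 4/3 ¾ M)))
    (*-mono-≤ˡ (0≤^ M (ℚ.nonNegative⁻¹ 4/3))
      (ℚ.≤-trans (^-mono-≤ M 0≤¾ ¾≤rate) (^-antitone 0≤rate rate≤1 s≤M)))

-- `t` and `c` are to be 3 and 1/4. The gap `1 / (4 A (M + 1))` is at most 1/4, which keeps the rate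
-- at `¾` or more, and `A * M * δ` is at most 1, so Bernoulli's inequality gives `decay`.
rate-from-gap : ∀ {A δ t c} M → 1ℚ ≤ A → 0ℚ < δ → 0ℚ ≤ t → (t + 1ℚ) * c ≡ 1ℚ → c ≤ 1ℚ → ¾ + c ≡ 1ℚ →
  A * ((t + 1ℚ) * (ι M + 1ℚ)) * δ ≡ 1ℚ → Rate A M
rate-from-gap {A} {δ} {t} {c} M 1≤A δ>0 0≤t fc≡1 c≤1 ¾+c≡1 Kδ≡1 =
  record { gap = δ ; 0<gap = δ>0 ; ¾≤rate = ¾≤ ; decay = decay }
  where
  m : ℚ
  m = ι M
  0≤A : 0ℚ ≤ A
  0≤A = ℚ.≤-trans 0≤1 1≤A
  0≤δ : 0ℚ ≤ δ
  0≤δ = ℚ.<⇒≤ δ>0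
  δ≤c : δ ≤ c
  δ≤c = ℚ.≤-trans
    (≤-by (((A - 1ℚ) + A * m) * δ) (0≤* (0≤+ (0≤-diff 1≤A) (0≤* 0≤A (0≤ι M))) 0≤δ) (lemma₁ A m δ))
    (ℚ.≤-reflexive (trans (trans (sym (ℚ.*-identityˡ _)) (cong (_* (A * (m + 1ℚ) * δ)) (sym fc≡1)))
      (trans (lemma₂ A m δ (t + 1ℚ) c) (trans (cong (_* c) Kδ≡1) (ℚ.*-identityˡ c)))))
    where
    lemma₁ : ∀ A m δ → δ + ((A - 1ℚ) + A * m) * δ ≡ A * (m + 1ℚ) * δ
    lemma₁ = solve-∀ ℚ-ring
    lemma₂ : ∀ A m δ f c → (f * c) * (A * (m + 1ℚ) * δ) ≡ A * (f * (m + 1ℚ)) * δ * c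
    lemma₂ = solve-∀ ℚ-ring
  ¾≤ : ¾ ≤ 1ℚ - δ
  ¾≤ = ≤-by (c - δ) (0≤-diff δ≤c) (trans (lemma δ ¾ c) (cong (_- δ) ¾+c≡1))
    where
    lemma : ∀ δ a c → a + (c - δ) ≡ (a + c) - δ
    lemma = solve-∀ ℚ-ring
  decay : A - 1ℚ ≤ A * (1ℚ - δ) ^ M
  decay = ℚ.≤-trans
    (subst (λ e → A - e ≤ A * (1ℚ - m * δ)) Kδ≡1
      (≤-by ((t * (A * m) + (t + 1ℚ) * A) * δ)
        (0≤* (0≤+ (0≤* 0≤t (0≤* 0≤A (0≤ι M))) (0≤* (0≤+ 0≤t 0≤1) 0≤A)) 0≤δ)
        (lemma A m δ t)))
    (*-mono-≤ˡ 0≤A (bernoulli M 0≤δ (ℚ.≤-trans δ≤c c≤1)))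
    where
    lemma : ∀ A m δ t → A - A * ((t + 1ℚ) * (m + 1ℚ)) * δ + (t * (A * m) + (t + 1ℚ) * A) * δ ≡ A * (1ℚ - m * δ)
    lemma = solve-∀ ℚ-ring

rate-exists : ∀ {A} M → 1ℚ ≤ A → Rate A M
rate-exists {A} M 1≤A =
  let δ , δ>0 , Kδ≡1 = divide (A * ((ι 3 + 1ℚ) * (ι M + 1ℚ))) 1ℚ (K>0 (0≤ι 3)) (ℚ.positive⁻¹ 1ℚ)
  in rate-from-gap {t = ι 3} {c = + 1 / 4} M 1≤A δ>0 (0≤ι 3) refl (≤-by ¾ 0≤¾ refl) refl Kδ≡1
  where
  K>0 : ∀ {t} → 0ℚ ≤ t → 0ℚ < A * ((t + 1ℚ) * (ι M + 1ℚ))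
  K>0 {t} 0≤t = ℚ.<-≤-trans (ℚ.positive⁻¹ 1ℚ) (≤-by ((A - 1ℚ) + (t * A + (t + 1ℚ) * (A * ι M)))
    (0≤+ (0≤-diff 1≤A) (0≤+ (0≤* 0≤t (ℚ.≤-trans 0≤1 1≤A))
      (0≤* (0≤+ 0≤t 0≤1) (0≤* (ℚ.≤-trans 0≤1 1≤A) (0≤ι M))))) (lemma A (ι M) t))
    where
    lemma : ∀ A m t → 1ℚ + ((A - 1ℚ) + (t * A + (t + 1ℚ) * (A * m))) ≡ A * ((t + 1ℚ) * (m + 1ℚ))
    lemma = solve-∀ ℚ-ring

-- Finite sums of rationals

module Σℚ = Sum ℚ.+-0-isCommutativeMonoid
open Σℚ using (sum)

module _ {X : Set} where

  sum-const : (xs : List X) (c : ℚ) → sum xs (λ _ → c) ≡ ι (length xs) * c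
  sum-const []       c = sym (ℚ.*-zeroˡ c)
  sum-const (x ∷ xs) c = trans (cong (λ t → c + t) (sum-const xs c))
    (trans (lemma c (ι (length xs))) (cong (_* c) (sym (ι-suc (length xs)))))
    where
    lemma : ∀ c n → c + n * c ≡ (n + 1ℚ) * c
    lemma = solve-∀ ℚ-ring

  sum-mono : (xs : List X) {g h : X → ℚ} → (∀ x → g x ≤ h x) → sum xs g ≤ sum xs h
  sum-mono []       g≤h = ℚ.≤-refl
  sum-mono (x ∷ xs) g≤h = ℚ.+-mono-≤ (g≤h x) (sum-mono xs g≤h)

  sum-nonneg : (xs : List X) {g : X → ℚ} → (∀ x → 0ℚ ≤ g x) → 0ℚ ≤ sum xs g
  sum-nonneg []       0≤g = ℚ.≤-refl
  sum-nonneg (x ∷ xs) 0≤g = 0≤+ (0≤g x) (sum-nonneg xs 0≤g)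

  ∈-≤-sum : {xs : List X} {g : X → ℚ} → (∀ x → 0ℚ ≤ g x) → ∀ {x} → x ∈ xs → g x ≤ sum xs g
  ∈-≤-sum {_ ∷ xs} {g} 0≤g (here refl)     = ≤-by (sum xs g) (sum-nonneg xs 0≤g) refl
  ∈-≤-sum {y ∷ xs} {g} 0≤g {x} (there x∈) = ℚ.≤-trans (∈-≤-sum 0≤g x∈) (≤-by (g y) (0≤g y) (ℚ.+-comm _ (g y)))

  sum-neg : (xs : List X) (g : X → ℚ) → sum xs (λ x → - g x) ≡ - sum xs g
  sum-neg []       g = refl
  sum-neg (x ∷ xs) g = trans (cong (λ t → - g x + t) (sum-neg xs g)) (sym (ℚ.neg-distrib-+ (g x) (sum xs g)))

  sum-*ˡ : (xs : List X) (a : ℚ) (g : X → ℚ) → sum xs (λ x → a * g x) ≡ a * sum xs g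
  sum-*ˡ []       a g = sym (ℚ.*-zeroʳ a)
  sum-*ˡ (x ∷ xs) a g = trans (cong (λ t → a * g x + t) (sum-*ˡ xs a g)) (sym (ℚ.*-distribˡ-+ a (g x) _))

  sum-abs-≤ : (xs : List X) {g : X → ℚ} {K : ℚ} → (∀ x → ∣ g x ∣ ≤ K) → ∣ sum xs g ∣ ≤ ι (length xs) * K
  sum-abs-≤ xs {g} {K} g≤K = ∣∣-≤
    (ℚ.≤-trans (sum-mono xs (λ x → ℚ.≤-trans (p≤∣p∣ (g x)) (g≤K x))) (ℚ.≤-reflexive (sum-const xs K)))
    (ℚ.≤-trans (ℚ.≤-reflexive (sym (sum-neg xs g)))
      (ℚ.≤-trans (sum-mono xs (λ x → ℚ.≤-trans (-p≤∣p∣ (g x)) (g≤K x))) (ℚ.≤-reflexive (sum-const xs K))))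

  sum-neg-< : (xs : List X) {g : X → ℚ} → (∀ {x} → x ∈ xs → g x < 0ℚ) → sum xs g ≤ 0ℚ
  sum-neg-< []       g<0 = ℚ.≤-refl
  sum-neg-< (x ∷ xs) {g} g<0 = subst (g x + sum xs g ≤_) (ℚ.+-identityˡ 0ℚ)
    (ℚ.+-mono-≤ (ℚ.<⇒≤ (g<0 (here refl))) (sum-neg-< xs (g<0 ∘ there)))

  -- Were all values on the nonempty list negative, the sum would be negative.
  sum-zero⇒nonneg : {xs : List X} (g : X → ℚ) → sum xs g ≡ 0ℚ → ∀ {x} → x ∈ xs → ∃[ y ] 0ℚ ≤ g y
  sum-zero⇒nonneg {x ∷ xs} g Σ≡0 _ with Any.any? (λ y → 0ℚ ℚ.≤? g y) (x ∷ xs)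
  ... | yes some = let y , _ , 0≤gy = find some in y , 0≤gy
  ... | no none  = ⊥-elim (ℚ.<-irrefl Σ≡0 (subst (g x + sum xs g <_) (ℚ.+-identityˡ 0ℚ)
    (ℚ.+-mono-<-≤ (neg (here refl)) (sum-neg-< xs (neg ∘ there)))))
    where
    neg : ∀ {y} → y ∈ x ∷ xs → g y < 0ℚ
    neg y∈ = ℚ.≰⇒> (none ∘ lose y∈)

  -- Shifted by `τ` all terms are nonnegative, so the total is at least any one of them. This is a
  -- single step of the Doeblin estimate.
  sum-lower : {xs : List X} {g : X → ℚ} {τ : ℚ} → (∀ x → 0ℚ ≤ g x + τ) →
    ∀ {x} → x ∈ xs → g x + τ ≤ sum xs g + ι (length xs) * τ
  sum-lower {xs} {g} {τ} 0≤ x∈ = ℚ.≤-trans (∈-≤-sum 0≤ x∈)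
    (ℚ.≤-reflexive (trans (Σℚ.sum-∙ xs g (λ _ → τ)) (cong (λ t → sum xs g + t) (sum-const xs τ))))

  sum-nonneg-shift : (xs : List X) {g : X → ℚ} {τ : ℚ} → (∀ x → 0ℚ ≤ g x + τ) → 0ℚ ≤ sum xs g + ι (length xs) * τ
  sum-nonneg-shift xs {g} {τ} 0≤ = ℚ.≤-trans (sum-nonneg xs 0≤)
    (ℚ.≤-reflexive (trans (Σℚ.sum-∙ xs g (λ _ → τ)) (cong (λ t → sum xs g + t) (sum-const xs τ))))

-- The non-backtracking shift

module Dynamics (G : Graph) {q : ℕ} (reg : Regular G (suc q)) (2≤q : 2 ℕ.≤ q) where
  open Darts G
  open Reg reg

  Q : ℚ
  Q = ι q

  0≤Q : 0ℚ ≤ Q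
  0≤Q = 0≤ι q

  -- The sum over the `q` successors instead of their mean avoids division; the factors `Q ^ k`
  -- below are the normalisation of `k` steps.
  advance : (Dart G → ℚ) → Dart G → ℚ
  advance g d = sum (succ d) g

  iter : ℕ → (Dart G → ℚ) → Dart G → ℚ
  iter zero    g = g
  iter (suc k) g = iter k (advance g)

  -- Every dart has `q` predecessors, so the uniform distribution is stationary and functions of
  -- mean zero stay such.
  sum-advance : ∀ g → sum (darts G) (advance g) ≡ Q * sum (darts G) g
  sum-advance g = begin
    sum (darts G) (λ d → sum (succ d) g)
      ≡⟨ Σℚ.sum-filter-swap _↝?_ (darts G) (darts G) (λ _ → g) ⟩
    sum (darts G) (λ e → sum (pred e) (λ _ → g e))
      ≡⟨ Σℚ.sum-cong (darts G) (λ e → trans (sum-const (pred e) (g e)) (cong (λ n → ι n * g e) (length-pred e))) ⟩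
    sum (darts G) (λ e → Q * g e)
      ≡⟨ sum-*ˡ (darts G) Q g ⟩
    Q * sum (darts G) g ∎
    where open ≡-Reasoning

  Centred : (Dart G → ℚ) → Set
  Centred g = sum (darts G) g ≡ 0ℚ

  iter-centred : ∀ k {g} → Centred g → Centred (iter k g)
  iter-centred zero    c = c
  iter-centred (suc k) {g} c = iter-centred k (trans (sum-advance g) (trans (cong (Q *_) c) (ℚ.*-zeroʳ Q)))

  iter-cong : ∀ k {g h} → (∀ d → g d ≡ h d) → ∀ d → iter k g d ≡ iter k h d
  iter-cong zero    eq = eq
  iter-cong (suc k) eq = iter-cong k (λ d → Σℚ.sum-cong (succ d) eq)

  iter-neg : ∀ k g d → iter k (λ e → - g e) d ≡ - iter k g d
  iter-neg zero    g d = refl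
  iter-neg (suc k) g d = trans (iter-cong k (λ e → sum-neg (succ e) g) d) (iter-neg k (advance g) d)

  iter-+ : ∀ j k g → iter (j ℕ.+ k) g ≡ iter k (iter j g)
  iter-+ zero    k g = refl
  iter-+ (suc j) k g = iter-+ j k (advance g)

  advance-bound : ∀ {g τ} → (∀ d → ∣ g d ∣ ≤ τ) → ∀ d → ∣ advance g d ∣ ≤ Q * τ
  advance-bound {g} {τ} g≤τ d = subst (λ n → ∣ advance g d ∣ ≤ ι n * τ) (length-succ d) (sum-abs-≤ (succ d) g≤τ)

  iter-bound : ∀ k {g τ} → (∀ d → ∣ g d ∣ ≤ τ) → ∀ d → ∣ iter k g d ∣ ≤ Q ^ k * τ
  iter-bound zero    {τ = τ} g≤τ d = ℚ.≤-trans (g≤τ d) (ℚ.≤-reflexive (sym (ℚ.*-identityˡ τ)))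
  iter-bound (suc k) {τ = τ} g≤τ d =
    ℚ.≤-trans (iter-bound k (advance-bound g≤τ) d) (ℚ.≤-reflexive (lemma Q (Q ^ k) τ))
    where
    lemma : ∀ a b c → b * (a * c) ≡ a * b * c
    lemma = solve-∀ ℚ-ring

  -- One chain of darts from `d` to `e` is followed: at each step `sum-lower` keeps its term and
  -- drops the others, and the shift grows by the factor `Q`.
  iter-lower : ∀ k {g τ} → (∀ e → 0ℚ ≤ g e + τ) → ∀ {d e} → e ∈ reach-from 2≤q k (d ∷ []) →
    g e + τ ≤ iter k g d + Q ^ k * τ
  iter-lower zero    {g} {τ} 0≤ {d} (here refl) =
    ℚ.≤-reflexive (cong (λ t → g d + t) (sym (ℚ.*-identityˡ τ)))
  iter-lower (suc k) {g} {τ} 0≤ {d} {e} e∈ with ∈-image⁻ (reach-from 2≤q k (d ∷ [])) e∈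
  ... | c , c∈ , c↝e = ℚ.≤-trans
    (subst (λ n → g e + τ ≤ advance g c + ι n * τ) (length-succ c) (sum-lower 0≤ (∈-succ c↝e)))
    (ℚ.≤-trans (iter-lower k 0≤advance c∈) (ℚ.≤-reflexive (cong (λ t → iter k (advance g) d + t) (lemma Q (Q ^ k) τ))))
    where
    lemma : ∀ a b c → b * (a * c) ≡ a * b * c
    lemma = solve-∀ ℚ-ring
    0≤advance : ∀ d → 0ℚ ≤ advance g d + Q * τ
    0≤advance d = subst (λ n → 0ℚ ≤ advance g d + ι n * τ) (length-succ d) (sum-nonneg-shift (succ d) 0≤)

  1≤Q : 1ℚ ≤ Q
  1≤Q = subst (λ n → 1ℚ ≤ ι n) (ℕ.suc-pred q {{ℕ.>-nonZero (ℕ.≤-trans (s≤s z≤n) 2≤q)}}) (1≤ι-suc (ℕ.pred q))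

  module Mixing (M : ℕ) .{{_ : ℕ.NonZero M}} (reaches : ∀ d → Full (reach-from 2≤q M (d ∷ [])))
                (R : Rate (Q ^ M) M) where
    open Rate R

    -- A centred g has g e ≥ 0 somewhere, and e is reached from d in M steps, so at least one of
    -- the Q ^ M terms of iter M g d exceeds its lower bound - τ by τ.
    contraction-below : ∀ {g τ} → Centred g → (∀ d → ∣ g d ∣ ≤ τ) → ∀ d → - iter M g d ≤ (Q ^ M - 1ℚ) * τ
    contraction-below {g} {τ} centred g≤τ d with sum-zero⇒nonneg {xs = darts G} g centred (dart∈ d)
    ... | e , 0≤ge = ≤-by (iter M g d + Q ^ M * τ - (g e + τ) + g e)
        (0≤+ (0≤-diff (iter-lower M shifted (reaches d e))) 0≤ge)
        (lemma (iter M g d) (Q ^ M) τ (g e))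
      where
      shifted : ∀ e → 0ℚ ≤ g e + τ
      shifted e = subst (0ℚ ≤_) (lemma′ τ (g e)) (0≤-diff (ℚ.≤-trans (-p≤∣p∣ (g e)) (g≤τ e)))
        where
        lemma′ : ∀ a b → a - (- b) ≡ b + a
        lemma′ = solve-∀ ℚ-ring
      lemma : ∀ a b τ c → - a + (a + b * τ - (c + τ) + c) ≡ (b - 1ℚ) * τ
      lemma = solve-∀ ℚ-ring

    -- The upper bound is `contraction-below` applied to `- g`.
    contraction : ∀ {g τ} → Centred g → (∀ d → ∣ g d ∣ ≤ τ) → ∀ d → ∣ iter M g d ∣ ≤ (Q ^ M - 1ℚ) * τ
    contraction {g} {τ} centred g≤τ d = ∣∣-≤
      (subst (_≤ (Q ^ M - 1ℚ) * τ) (trans (cong -_ (iter-neg M g d)) (neg-neg (iter M g d)))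
        (contraction-below {g = λ e → - g e}
          (trans (sum-neg (darts G) g) (cong -_ centred))
          (λ e → subst (_≤ τ) (sym (ℚ.∣-p∣≡∣p∣ (g e))) (g≤τ e)) d))
      (contraction-below centred g≤τ d)
      where
      neg-neg : ∀ a → - (- a) ≡ a
      neg-neg = solve-∀ ℚ-ring

    -- Each full block multiplies the bound by `Q ^ M - 1 ≤ Q ^ M * rate ^ M`. The remaining `s`
    -- steps get the trivial factor `Q ^ s`, with `4/3 ^ M` compensating for `rate ^ s`.
    decay-blocks : ∀ j {s} → s ℕ.≤ M → ∀ {g τ} → 0ℚ ≤ τ → Centred g → (∀ d → ∣ g d ∣ ≤ τ) →
      ∀ d → ∣ iter (j ℕ.* M ℕ.+ s) g d ∣ ≤ Q ^ (j ℕ.* M ℕ.+ s) * (4/3 ^ M * rate ^ (j ℕ.* M ℕ.+ s)) * τ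
    decay-blocks zero {s} s≤M {g} {τ} 0≤τ centred g≤τ d = ℚ.≤-trans (iter-bound s g≤τ d)
      (*-mono-≤ʳ 0≤τ (subst (_≤ Q ^ s * (4/3 ^ M * rate ^ s)) (ℚ.*-identityʳ (Q ^ s))
        (*-mono-≤ˡ (0≤^ s 0≤Q) (rate-absorbs s≤M))))
    decay-blocks (suc j) {s} s≤M {g} {τ} 0≤τ centred g≤τ d
      rewrite ℕ.+-assoc M (j ℕ.* M) s | iter-+ M (j ℕ.* M ℕ.+ s) g
            | ^-homo-* Q M (j ℕ.* M ℕ.+ s) | ^-homo-* rate M (j ℕ.* M ℕ.+ s) =
      ℚ.≤-trans (decay-blocks j s≤M (0≤* (0≤* (0≤^ M 0≤Q) (0≤^ M 0≤rate)) 0≤τ) (iter-centred M centred)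
          (λ e → ℚ.≤-trans (contraction centred g≤τ e) (*-mono-≤ʳ 0≤τ decay)) d)
        (ℚ.≤-reflexive (lemma (Q ^ (j ℕ.* M ℕ.+ s)) (4/3 ^ M) (rate ^ (j ℕ.* M ℕ.+ s)) (Q ^ M) (rate ^ M) τ))
      where
      lemma : ∀ a c b A B τ → a * (c * b) * (A * B * τ) ≡ A * a * (c * (B * b)) * τ
      lemma = solve-∀ ℚ-ring

    exponential-decay : ∀ r {g τ} → 0ℚ ≤ τ → Centred g → (∀ d → ∣ g d ∣ ≤ τ) →
      ∀ d → ∣ iter r g d ∣ ≤ Q ^ r * (4/3 ^ M * rate ^ r) * τ
    exponential-decay r {g} {τ} 0≤τ centred g≤τ d =
      subst (λ n → ∣ iter n g d ∣ ≤ Q ^ n * (4/3 ^ M * rate ^ n) * τ)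
        (trans (ℕ.+-comm (r ℕ./ M ℕ.* M) (r ℕ.% M)) (sym (ℕ.m≡m%n+[m/n]*n r M)))
        (decay-blocks (r ℕ./ M) (ℕ.<⇒≤ (ℕ.m%n<n r M)) 0≤τ centred g≤τ d)

unique-concatMap : {A B : Set} {h : A → List B} → (∀ x → Unique (h x)) →
  (∀ {x y z} → z ∈ h x → z ∈ h y → x ≡ y) → ∀ {xs} → Unique xs → Unique (concatMap h xs)
unique-concatMap uh inj []       = []
unique-concatMap {h = h} uh inj {x ∷ xs} (x∉ ∷ uxs) =
  Unique.++⁺ (uh x) (unique-concatMap uh inj uxs) disjoint
  where
  disjoint : ∀ {z} → ¬ (z ∈ h x × z ∈ concatMap h xs)
  disjoint (z∈x , z∈xs) with find (∈-concatMap⁻ h {xs = xs} z∈xs)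
  ... | y , y∈ , z∈y = All.lookup x∉ y∈ (inj z∈x z∈y)

-- The universal cover and its tubes

module Paths (G : Graph) (root : Vertex G) where
  open Darts G

  Path : Set
  Path = List (Dart G)

  _≟ᵖ_ : DecidableEquality Path
  _≟ᵖ_ = List.≡-dec (_≟ᵈ_ G)

  NB : Path → Set
  NB = NonBacktracking G root

  end : Path → Vertex G
  end = endpoint G root

  -- Appending a step with free reduction, as a letter multiplies a reduced word. The neighbours of
  -- a vertex of the cover arise in this way from the darts leaving its end.
  act : Path → Dart G → Path
  act []       d = d ∷ []
  act (e ∷ ds) d = if does (_≟ᵈ_ G d (reverse G e)) then ds else d ∷ e ∷ ds

  act-cancel : ∀ e ds → act (e ∷ ds) (reverse G e) ≡ ds
  act-cancel e ds = cong (if_then ds else reverse G e ∷ e ∷ ds) (dec-true (_≟ᵈ_ G (reverse G e) (reverse G e)) refl)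

  act-extend : ∀ {d} ds → NotReversal G root d ds → act ds d ≡ d ∷ ds
  act-extend []       _  = refl
  act-extend {d} (e ∷ ds) ne = cong (if_then ds else d ∷ e ∷ ds) (dec-false (_≟ᵈ_ G d (reverse G e)) ne)

  data Action (d : Dart G) : Path → Set where
    cancels : ∀ e es → d ≡ reverse G e → Action d (e ∷ es)
    extends : ∀ {ds} → NotReversal G root d ds → Action d ds

  action : ∀ d ds → Action d ds
  action d [] = extends tt
  action d (e ∷ es) with _≟ᵈ_ G d (reverse G e)
  ... | yes eq = cancels e es eq
  ... | no  ne = extends ne

  act-NB : ∀ {ds d} → NB ds → source G d ≡ end ds → NB (act ds d)
  act-NB {ds} {d} nb s with action d ds
  ... | cancels e es refl = subst NB (sym (act-cancel e es)) (proj₂ (proj₂ nb))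
  ... | extends ne      = subst NB (sym (act-extend ds ne)) (s , ne , nb)

  -- After a cancellation the removed step goes back on without reduction, because the original path
  -- was non-backtracking.
  act-inverse : ∀ {ds d} → NB ds → source G d ≡ end ds → act (act ds d) (reverse G d) ≡ ds
  act-inverse {ds} {d} nb s with action d ds
  act-inverse {_} {d} (s , ne , nb) _ | cancels e es refl = begin
    act (act (e ∷ es) d) (reverse G d) ≡⟨ cong₂ act (act-cancel e es) (reverse² e) ⟩
    act es e                           ≡⟨ act-extend es ne ⟩
    e ∷ es                             ∎
    where open ≡-Reasoning
  ... | extends ne = trans (cong (λ t → act t (reverse G d)) (act-extend ds ne)) (act-cancel d ds)

  act-end : ∀ {ds d} → NB ds → source G d ≡ end ds → end (act ds d) ≡ target G d
  act-end {ds} {d} nb s with action d ds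
  act-end (s , _) _ | cancels e es refl =
    trans (cong end (act-cancel e es)) (trans (sym s) (sym (target-reverse e)))
  ... | extends ne = cong end (act-extend ds ne)

  vertex-NB : ∀ v → NB (steps {G = G} {root = root} v)
  vertex-NB (path ds p) = recompute (nonBacktracking? G root ds) p

  ~⇒act : ∀ {u v} → _~_ G root u v → ∃[ d ] source G d ≡ end (steps u) × steps v ≡ act (steps u) d
  ~⇒act {u} {v} (d , inj₁ eq) = reverse G d , trans (source-reverse d) (sym (cong end eq)) ,
    sym (trans (cong (λ t → act t (reverse G d)) eq) (act-cancel d (steps v)))
  ~⇒act {u} {v} (d , inj₂ eq) with subst NB eq (vertex-NB v)
  ... | s , ne , _ = d , s , trans eq (sym (act-extend (steps u) ne))

  act⇒~ : ∀ {u v} d → steps v ≡ act (steps u) d → _~_ G root u v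
  act⇒~ {u} d eq with steps u | action d (steps u)
  ... | _  | cancels e es refl = e , inj₁ (cong (e ∷_) (sym (trans eq (act-cancel e es))))
  ... | ds | extends ne      = d , inj₂ (trans eq (act-extend ds ne))

-- Vertices of the cover described relative to X

module Tubes (G : Graph) (root : Vertex G) (X : FiniteSubgraph G root)
             {x₀ : CoverVertex G root} (x₀∈ : x₀ ∈ vertexList X) (connected : ConnectedSubgraph G root X) where
  open Darts G
  open Paths G root
  open import Data.List.Membership.DecPropositional _≟ᵖ_ using (_∈?_)

  members-of-X : List Path
  members-of-X = map steps (vertexList X)

  -- (x , dₖ ∷ … ∷ d₁) stands for the vertex reached from x ∈ X by following d₁ , … , dₖ away from X.
  Code : Set
  Code = Path × Path

  code-end : Code → Vertex G
  code-end (x , [])    = end x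
  code-end (x , d ∷ _) = target G d

  eval : Code → Path
  eval (x , [])     = x
  eval (x , e ∷ es) = act (eval (x , es)) e

  -- Only the first step is compared with `X`: in a tree, a non-backtracking path that has left a
  -- connected subgraph never returns to it.
  Outward : Code → Dart G → Set
  Outward (x , [])    e = source G e ≡ end x × act x e ∉ members-of-X
  Outward (x , d ∷ _) e = d ↝ e

  Valid : Code → Set
  Valid (x , [])     = x ∈ members-of-X
  Valid (x , e ∷ es) = Outward (x , es) e × Valid (x , es)

  push : Code → Dart G → Code
  push (x , ds) e = x , e ∷ ds

  infixl 5 _▹_

  -- The counterpart of `act` on codes (`▹-eval`). From a code without steps it either moves the
  -- base point within `X` or starts an outward path; otherwise the base point is kept.
  _▹_ : Code → Dart G → Code
  (x , [])     ▹ d = if does (act x d ∈? members-of-X) then (act x d , []) else (x , d ∷ [])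
  (x , e ∷ es) ▹ d = x , act (e ∷ es) d

  ▹-inside : ∀ {x d} → act x d ∈ members-of-X → (x , []) ▹ d ≡ (act x d , [])
  ▹-inside {x} {d} p = cong (if_then (act x d , []) else (x , d ∷ [])) (dec-true (act x d ∈? members-of-X) p)

  ▹-outside : ∀ {x d} → act x d ∉ members-of-X → (x , []) ▹ d ≡ (x , d ∷ [])
  ▹-outside {x} {d} p = cong (if_then (act x d , []) else (x , d ∷ [])) (dec-false (act x d ∈? members-of-X) p)

  ▹-outward : ∀ c {d} → Outward c d → c ▹ d ≡ push c d
  ▹-outward (x , [])     (_ , ∉) = ▹-outside ∉
  ▹-outward (x , e ∷ es) (_ , ne) = cong (x ,_) (act-extend (e ∷ es) ne)

  Outward-source : ∀ c {d} → Outward c d → source G d ≡ code-end c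
  Outward-source (x , [])    = proj₁
  Outward-source (x , _ ∷ _) = proj₁

  member-NB : ∀ {x} → x ∈ members-of-X → NB x
  member-NB x∈ with ∈-map⁻ steps x∈
  ... | v , _ , refl = vertex-NB v

  eval-spec : ∀ c → Valid c → NB (eval c) × end (eval c) ≡ code-end c
  eval-spec (x , [])     x∈ = member-NB x∈ , refl
  eval-spec (x , e ∷ es) (out , valid) with eval-spec (x , es) valid
  ... | nb , end≡ = act-NB nb s , act-end nb s
    where
    s : source G e ≡ end (eval (x , es))
    s = trans (Outward-source (x , es) out) (sym end≡)

  ▹-valid : ∀ c {d} → Valid c → source G d ≡ code-end c → Valid (c ▹ d)
  ▹-valid (x , []) {d} x∈ s with act x d ∈? members-of-X
  ... | yes p = p
  ... | no  p = (s , p) , x∈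
  ▹-valid (x , e ∷ es) {d} valid s with action d (e ∷ es)
  ... | cancels _ _ refl = subst (λ t → Valid (x , t)) (sym (act-cancel e es)) (proj₂ valid)
  ... | extends ne     = subst (λ t → Valid (x , t)) (sym (act-extend (e ∷ es) ne)) ((s , ne) , valid)

  ▹-inverse : ∀ c {d} → Valid c → source G d ≡ code-end c → c ▹ d ▹ reverse G d ≡ c
  ▹-inverse (x , []) {d} x∈ s with act x d ∈? members-of-X
  ... | yes p = trans (▹-inside (subst (_∈ members-of-X) (sym back) x∈)) (cong (_, []) back)
    where
    back : act (act x d) (reverse G d) ≡ x
    back = act-inverse (member-NB x∈) s
  ... | no  p = cong (x ,_) (act-cancel d [])
  ▹-inverse (x , e ∷ es) {d} (out , valid) s with action d (e ∷ es)
  ... | cancels _ _ refl = begin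
    (x , act (e ∷ es) d) ▹ reverse G d ≡⟨ cong₂ (λ t d → (x , t) ▹ d) (act-cancel e es) (reverse² e) ⟩
    (x , es) ▹ e                       ≡⟨ ▹-outward (x , es) out ⟩
    (x , e ∷ es)                       ∎
    where open ≡-Reasoning
  ... | extends ne = trans (cong (λ t → (x , t) ▹ reverse G d) (act-extend (e ∷ es) ne))
    (cong (x ,_) (act-cancel d (e ∷ es)))

  ▹-eval : ∀ c {d} → Valid c → eval (c ▹ d) ≡ act (eval c) d
  ▹-eval (x , []) {d} x∈ with act x d ∈? members-of-X
  ... | yes p = refl
  ... | no  p = refl
  ▹-eval (x , e ∷ es) {d} (out , valid) with action d (e ∷ es)
  ... | cancels _ _ refl = trans (cong (λ t → eval (x , t)) (act-cancel e es))
    (sym (act-inverse (proj₁ spec) (trans (Outward-source (x , es) out) (sym (proj₂ spec)))))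
    where
    spec : NB (eval (x , es)) × end (eval (x , es)) ≡ code-end (x , es)
    spec = eval-spec (x , es) valid
  ... | extends ne = cong (λ t → eval (x , t)) (act-extend (e ∷ es) ne)

  height : Code → ℕ
  height = length ∘ proj₂

  -- A step lowers the height by at most one, so the height bounds the length of every walk to `X`
  -- from below.
  ▹-height : ∀ c d → height c ℕ.≤ suc (height (c ▹ d))
  ▹-height (x , [])     d = z≤n
  ▹-height (x , e ∷ es) d with action d (e ∷ es)
  ... | cancels _ _ refl = ℕ.≤-reflexive (cong (suc ∘ length) (sym (act-cancel e es)))
  ... | extends ne     = ℕ.≤-trans (ℕ.≤-trans (ℕ.n≤1+n _) (ℕ.n≤1+n _))
    (ℕ.≤-reflexive (cong (suc ∘ length) (sym (act-extend (e ∷ es) ne))))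

  replay rewind : Code → Path → Code
  replay c []       = c
  replay c (d ∷ ds) = replay c ds ▹ d
  rewind c []       = c
  rewind c (d ∷ ds) = rewind (c ▹ reverse G d) ds

  rewind-spec : ∀ c ds → Valid c → eval c ≡ ds → NB ds →
    Valid (rewind c ds) × eval (rewind c ds) ≡ [] × replay (rewind c ds) ds ≡ c
  rewind-spec c []       valid eq nb = valid , eq , refl
  rewind-spec c (d ∷ ds) valid eq (s , ne , nb)
    with rewind-spec (c ▹ reverse G d) ds (▹-valid c valid src)
           (trans (▹-eval c valid) (trans (cong (λ t → act t (reverse G d)) eq) (act-cancel d ds))) nb
    where
    src : source G (reverse G d) ≡ code-end c
    src = trans (source-reverse d) (trans (sym (cong end eq)) (proj₂ (eval-spec c valid)))
  ... | valid′ , ev , back = valid′ , ev , (begin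
    replay (rewind (c ▹ reverse G d) ds) ds ▹ d ≡⟨ cong (_▹ d) back ⟩
    c ▹ reverse G d ▹ d                         ≡⟨ cong (c ▹ reverse G d ▹_) (sym (reverse² d)) ⟩
    c ▹ reverse G d ▹ reverse G (reverse G d)   ≡⟨ ▹-inverse c valid
        (trans (source-reverse d) (trans (sym (cong end eq)) (proj₂ (eval-spec c valid)))) ⟩
    c                                           ∎)
    where open ≡-Reasoning

  -- The code of the root, which may lie outside `X`: it is found by undoing the path to `x₀` from
  -- the known code of `x₀`.
  base : Code
  base = rewind (steps x₀ , []) (steps x₀)

  base-spec : Valid base × eval base ≡ [] × replay base (steps x₀) ≡ (steps x₀ , [])
  base-spec = rewind-spec (steps x₀ , []) (steps x₀) (∈-map⁺ steps x₀∈) refl (vertex-NB x₀)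

  decode : Path → Code
  decode = replay base

  decode-spec : ∀ {ds} → NB ds → Valid (decode ds) × eval (decode ds) ≡ ds
  decode-spec {[]}     _ = proj₁ base-spec , proj₁ (proj₂ base-spec)
  decode-spec {d ∷ ds} (s , ne , nb) with decode-spec nb
  ... | valid , eq = ▹-valid (decode ds) valid src ,
      trans (▹-eval (decode ds) valid) (trans (cong (λ t → act t d) eq) (act-extend ds ne))
    where
    src : source G d ≡ code-end (decode ds)
    src = trans s (trans (sym (cong end eq)) (proj₂ (eval-spec (decode ds) valid)))

  decode-end : ∀ {ds} → NB ds → code-end (decode ds) ≡ end ds
  decode-end {ds} nb with decode-spec nb
  ... | valid , eq = trans (sym (proj₂ (eval-spec (decode ds) valid))) (cong end eq)

  -- `decode` recurses over the steps, so an appended step agrees with `▹` by definition; a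
  -- cancelled one does so by `▹-inverse`.
  decode-act : ∀ {ds d} → NB ds → source G d ≡ end ds → decode (act ds d) ≡ decode ds ▹ d
  decode-act {ds} {d} nb s with action d ds
  decode-act {_} (s , ne , nb) _ | cancels e es refl = trans (cong decode (act-cancel e es))
    (sym (▹-inverse (decode es) (proj₁ (decode-spec nb)) (trans s (sym (decode-end nb)))))
  ... | extends ne = cong decode (act-extend ds ne)

  decode-neighbour : ∀ {u v} → _~_ G root u v → ∃[ d ] steps v ≡ act (steps u) d × decode (steps v) ≡ decode (steps u) ▹ d
  decode-neighbour {u} {v} u~v with ~⇒act {u} {v} u~v
  ... | d , s , eq = d , eq , trans (cong decode eq) (decode-act (vertex-NB u) s)

  joined : ∀ {u v} → Joined G root X u v → _~_ G root u v × v ∈ vertexList X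
  joined (inj₁ e) with isEdge X e
  ... | u~v , _ , v∈ = u~v , v∈
  joined {u} {v} (inj₂ e) with isEdge X e
  ... | v~u , v∈ , _ = ~-sym G root v u v~u , v∈

  -- An edge of `X` joins two members, so `▹` takes its inside branch and no outward step appears.
  -- Connectedness of `X` then carries this from `x₀` to every member.
  decode-along : ∀ {u v} → Star (Joined G root X) u v →
    decode (steps u) ≡ (steps u , []) → decode (steps v) ≡ (steps v , [])
  decode-along Star.ε eq = eq
  decode-along {u} (_◅_ {j = w} j js) eq with joined j
  ... | u~w , w∈ with decode-neighbour {u} {w} u~w
  ...   | d , w≡ , dw = decode-along js (begin
    decode (steps w)      ≡⟨ dw ⟩
    decode (steps u) ▹ d  ≡⟨ cong (_▹ d) eq ⟩
    (steps u , []) ▹ d    ≡⟨ ▹-inside (subst (_∈ members-of-X) w≡ (∈-map⁺ steps w∈)) ⟩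
    (act (steps u) d , []) ≡⟨ cong (_, []) (sym w≡) ⟩
    (steps w , [])        ∎)
    where open ≡-Reasoning

  decode-member : ∀ {v} → v ∈ vertexList X → decode (steps v) ≡ (steps v , [])
  decode-member {v} v∈ = decode-along (connected x₀ v x₀∈ v∈) (proj₂ (proj₂ base-spec))

  -- With `decode-spec` this makes `decode` and `eval` inverse to each other: each vertex of the
  -- cover has exactly one valid code.
  decode-eval : ∀ c → Valid c → decode (eval c) ≡ c
  decode-eval (x , []) x∈ with ∈-map⁻ steps x∈
  ... | v , v∈ , refl = decode-member v∈
  decode-eval (x , e ∷ es) (out , valid) = begin
    decode (act (eval (x , es)) e) ≡⟨ decode-act (proj₁ spec)
                                        (trans (Outward-source (x , es) out) (sym (proj₂ spec))) ⟩
    decode (eval (x , es)) ▹ e     ≡⟨ cong (_▹ e) (decode-eval (x , es) valid) ⟩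
    (x , es) ▹ e                   ≡⟨ ▹-outward (x , es) out ⟩
    (x , e ∷ es)                   ∎
    where
    open ≡-Reasoning
    spec : NB (eval (x , es)) × end (eval (x , es)) ≡ code-end (x , es)
    spec = eval-spec (x , es) valid

  code : CoverVertex G root → Code
  code = decode ∘ steps

  code-valid : ∀ v → Valid (code v)
  code-valid v = proj₁ (decode-spec (vertex-NB v))

  code-injective : ∀ {u v} → code u ≡ code v → u ≡ v
  code-injective {u} {v} eq = steps-injective G root (trans (sym (proj₂ (decode-spec (vertex-NB u))))
    (trans (cong eval eq) (proj₂ (decode-spec (vertex-NB v)))))

  vertex : ∀ c → Valid c → CoverVertex G root
  vertex c valid = path (eval c) (proj₁ (eval-spec c valid))

  height-≤-walk : ∀ {n u x} → x ∈ vertexList X → Walk (_~_ G root) n u x → height (code u) ℕ.≤ n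
  height-≤-walk x∈ stop = ℕ.≤-reflexive (cong height (decode-member x∈))
  height-≤-walk {u = u} x∈ (step {y = y} u~y w) with decode-neighbour {u} {y} u~y
  ... | d , _ , eq = ℕ.≤-trans (▹-height (code u) d)
    (s≤s (ℕ.≤-trans (ℕ.≤-reflexive (cong height (sym eq))) (height-≤-walk x∈ w)))

  walk-to-X : ∀ c (valid : Valid c) → ∃[ x ] x ∈ vertexList X × Walk (_~_ G root) (height c) (vertex c valid) x
  walk-to-X (x , []) x∈ with ∈-map⁻ steps x∈
  ... | v , v∈ , refl = v , v∈ , stop
  walk-to-X (x , e ∷ es) valid@(_ , valid′) with walk-to-X (x , es) valid′
  ... | v , v∈ , w = v , v∈ , step (~-sym G root (vertex (x , es) valid′) (vertex (x , e ∷ es) valid)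
    (act⇒~ {u = vertex (x , es) valid′} {v = vertex (x , e ∷ es) valid} e refl)) w

  -- Retracing the outward path reaches `X` in as many steps as the height, and `height-≤-walk`
  -- excludes shorter walks; so the height is the distance to `X`.
  distance-to-X : ∀ v → ∃[ x ] x ∈ vertexList X × Distance (_~_ G root) v x (height (code v))
  distance-to-X v with walk-to-X (code v) (code-valid v)
  ... | x , x∈ , w = x , x∈ , subst (λ u → Walk (_~_ G root) (height (code v)) u x)
    (steps-injective G root (proj₂ (decode-spec (vertex-NB v)))) w , λ m → height-≤-walk x∈

  tube⇒height : ∀ {r v} → InTube G root X r v → height (code v) ≡ r
  tube⇒height {r} {v} ((x , x∈ , w , _) , least) with distance-to-X v
  ... | y , y∈ , δ = ℕ.≤-antisym (height-≤-walk x∈ w) (least y _ y∈ δ)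

  height⇒tube : ∀ v → InTube G root X (height (code v)) v
  height⇒tube v = distance-to-X v , λ x k x∈ δ → height-≤-walk x∈ (proj₁ δ)

  outward? : ∀ x e → Dec (Outward (x , []) e)
  outward? x e = source G e Fin.≟ end x ×-dec ¬? (act x e ∈? members-of-X)

  outward : Code → List (Dart G)
  outward (x , [])    = filter (outward? x) (darts G)
  outward (x , d ∷ _) = succ d

  ∈-outward : ∀ c {e} → Outward c e → e ∈ outward c
  ∈-outward (x , [])    {e} out = ∈-filter⁺ (outward? x) (dart∈ e) out
  ∈-outward (x , d ∷ _) out = ∈-succ out

  ∈-outward⁻ : ∀ c {e} → e ∈ outward c → Outward c e
  ∈-outward⁻ (x , [])    e∈ = proj₂ (∈-filter⁻ (outward? x) {xs = darts G} e∈)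
  ∈-outward⁻ (x , d ∷ _) e∈ = ∈-succ⁻ e∈

  outward-unique : ∀ c → Unique (outward c)
  outward-unique (x , [])    = Unique.filter⁺ (outward? x) darts-unique
  outward-unique (x , d ∷ _) = succ-unique d

  children : Code → List Code
  children c = map (push c) (outward c)

  -- The vertex list of `X` may have repetitions, which are removed at height 0; every code of
  -- greater height has a unique parent.
  layer : ℕ → List Code
  layer zero    = map (_, []) (deduplicate _≟ᵖ_ members-of-X)
  layer (suc r) = concatMap children (layer r)

  layer-sound : ∀ r {c} → c ∈ layer r → Valid c × height c ≡ r
  layer-sound zero c∈ with ∈-map⁻ (_, []) c∈
  ... | x , x∈ , refl = ∈-deduplicate⁻ _≟ᵖ_ members-of-X x∈ , refl
  layer-sound (suc r) c∈ with find (∈-concatMap⁻ children {xs = layer r} c∈)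
  ... | b , b∈ , c∈b with ∈-map⁻ (push b) c∈b
  ...   | e , e∈ , refl with layer-sound r b∈
  ...     | valid , h = (∈-outward⁻ b e∈ , valid) , cong suc h

  layer-complete : ∀ c → Valid c → c ∈ layer (height c)
  layer-complete (x , [])     x∈ = ∈-map⁺ (_, []) (∈-deduplicate⁺ _≟ᵖ_ x∈)
  layer-complete (x , e ∷ es) (out , valid) = ∈-concatMap⁺ children
    (lose (layer-complete (x , es) valid) (∈-map⁺ (push (x , es)) (∈-outward (x , es) out)))

  layer-unique : ∀ r → Unique (layer r)
  layer-unique zero    = Unique.map⁺ (cong proj₁) (deduplicate-! _≟ᵖ_ members-of-X)
  layer-unique (suc r) = unique-concatMap
    (λ c → Unique.map⁺ (λ eq → List.∷-injectiveˡ (cong proj₂ eq)) (outward-unique c)) same-parent (layer-unique r)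
    where
    same-parent : ∀ {b c z} → z ∈ children b → z ∈ children c → b ≡ c
    same-parent {b} {c} z∈b z∈c with ∈-map⁻ (push b) z∈b | ∈-map⁻ (push c) z∈c
    ... | _ , _ , refl | _ , _ , refl = refl

  tube : ℕ → List (CoverVertex G root)
  tube r = elements (𝓣 G root r X)

  -- As the height is the distance to `X`, `code` restricts to a bijection from the tube to the
  -- valid codes of height `r`.
  tube↭layer : ∀ r → map code (tube r) ↭ layer r
  tube↭layer r = unique-set⇒↭ (Unique.map⁺ code-injective (unique (𝓣 G root r X))) (layer-unique r) to from
    where
    to : ∀ {c} → c ∈ map code (tube r) → c ∈ layer r
    to c∈ with ∈-map⁻ code c∈
    ... | v , v∈ , refl = subst (λ n → code v ∈ layer n)
      (tube⇒height (Equivalence.to (members (𝓣 G root r X) v) v∈)) (layer-complete (code v) (code-valid v))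
    from : ∀ {c} → c ∈ layer r → c ∈ map code (tube r)
    from {c} c∈ with layer-sound r c∈
    ... | valid , refl = subst (_∈ map code (tube r)) code-v (∈-map⁺ code
        (Equivalence.from (members (𝓣 G root r X) v)
          (subst (λ n → InTube G root X n v) (cong height code-v) (height⇒tube v))))
      where
      v : CoverVertex G root
      v = vertex c valid
      code-v : code v ≡ c
      code-v = decode-eval c valid

  tube-sum : ∀ r (k : Vertex G → ℚ) → sum (tube r) (k ∘ π G root) ≡ sum (layer r) (k ∘ code-end)
  tube-sum r k = begin
    sum (tube r) (k ∘ π G root)          ≡⟨ Σℚ.sum-cong (tube r) (λ v → cong k (sym (decode-end (vertex-NB v)))) ⟩
    sum (tube r) (k ∘ code-end ∘ code)   ≡⟨ sym (Σℚ.sum-map code (tube r) (k ∘ code-end)) ⟩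
    sum (map code (tube r)) (k ∘ code-end) ≡⟨ Σℚ.sum-↭ (k ∘ code-end) (tube↭layer r) ⟩
    sum (layer r) (k ∘ code-end)         ∎
    where open ≡-Reasoning

  -- Tube sums as iterates of the shift

  module Growth {q : ℕ} (reg : Regular G (suc q)) (2≤q : 2 ℕ.≤ q) where
    open Reg reg
    open Dynamics G reg 2≤q

    forward-dart : ∀ x → ∃[ e ] source G e ≡ end x × NotReversal G root e x
    forward-dart (d ∷ _) with two-succ 2≤q d
    ... | e , _ , d↝e , _ = e , d↝e
    forward-dart [] with outgoing root | reg root | (λ {e} → ∈-filter⁻ (λ d → source G d Fin.≟ root) {v = e} {xs = darts G})
    ... | []    | () | _
    ... | e ∷ _ | _  | ∈⁻ = e , proj₂ (∈⁻ (here refl)) , tt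

    deepest : ∃[ x ] x ∈ members-of-X × (∀ {y} → y ∈ members-of-X → length y ℕ.≤ length x)
    deepest = argmax length (steps x₀) members-of-X ,
      argmax-all length {P = _∈ members-of-X} (∈-map⁺ steps x₀∈) (All.tabulate (λ y∈ → y∈)) ,
      λ y∈ → All.lookup (f[xs]≤f[argmax] {f = length} (steps x₀) members-of-X) y∈
      where open Extrema ℕ.≤-totalOrder

    child-exists : ∀ r {c} → c ∈ layer r → ∃[ d ] d ∈ outward c → ∃[ b ] b ∈ layer (suc r)
    child-exists r {c} c∈ (d , d∈) = push c d , ∈-concatMap⁺ children (lose c∈ (∈-map⁺ (push c) d∈))

    -- At radius 1 a longest path in `X` is extended: the result is longer than every member, hence
    -- outside `X`. From there on every dart has a successor.
    layer-nonempty : ∀ r → ∃[ c ] c ∈ layer r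
    layer-nonempty 0 = (steps x₀ , []) , layer-complete (steps x₀ , []) (∈-map⁺ steps x₀∈)
    layer-nonempty 1 with deepest
    ... | x , x∈ , longest with forward-dart x
    ...   | e , s , ne = child-exists 0 (layer-complete (x , []) x∈) (e , ∈-outward (x , []) (s , λ p →
      ℕ.<-irrefl refl (longest (subst (_∈ members-of-X) (act-extend x ne) p))))
    layer-nonempty (suc (suc r)) with layer-nonempty (suc r)
    ... | c@(_ , []) , c∈ = contradiction (proj₂ (layer-sound (suc r) c∈)) λ ()
    ... | c@(_ , d ∷ _) , c∈ with two-succ 2≤q d
    ...   | e , _ , d↝e , _ = child-exists (suc r) c∈ (e , ∈-succ d↝e)

    tube-nonempty : ∀ r → ∃[ v ] v ∈ tube r
    tube-nonempty r with layer-nonempty r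
    ... | c , c∈ with ∈-map⁻ code (∈-resp-↭ (↭.↭-sym (tube↭layer r)) c∈)
    ...   | v , v∈ , _ = v , v∈

    -- The edges of the cover that leave `X`, recorded by their darts in `G`; one dart may occur for
    -- several vertices of `X`.
    frontier : List (Dart G)
    frontier = concatMap outward (layer 0)

    outward-sum : ℕ → (Dart G → ℚ) → ℚ
    outward-sum r g = sum (layer r) (λ c → sum (outward c) g)

    -- The outward darts of `push c d` are `succ d` by definition, so the inner sum over children is
    -- `advance g`.
    outward-sum-suc : ∀ r g → outward-sum (suc r) g ≡ outward-sum r (advance g)
    outward-sum-suc r g = trans (Σℚ.sum-concatMap children (layer r) (λ c → sum (outward c) g))
      (Σℚ.sum-cong (layer r) (λ c → Σℚ.sum-map (push c) (outward c) (λ c → sum (outward c) g)))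

    outward-sum≡ : ∀ r g → outward-sum r g ≡ sum frontier (iter r g)
    outward-sum≡ zero    g = sym (Σℚ.sum-concatMap outward (layer 0) g)
    outward-sum≡ (suc r) g = trans (outward-sum-suc r g) (outward-sum≡ r (advance g))

    -- The first of the `suc r` outward steps picks a dart of the frontier, which leaves `r` steps
    -- of the shift.
    layer-sum : ∀ r (k : Vertex G → ℚ) → sum (layer (suc r)) (k ∘ code-end) ≡ sum frontier (iter r (k ∘ target G))
    layer-sum r k = trans (Σℚ.sum-concatMap children (layer r) (k ∘ code-end))
      (trans (Σℚ.sum-cong (layer r) (λ c → Σℚ.sum-map (push c) (outward c) (k ∘ code-end)))
        (outward-sum≡ r (k ∘ target G)))

    iter-const : ∀ r a d → iter r (λ _ → a) d ≡ Q ^ r * a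
    iter-const zero    a d = sym (ℚ.*-identityˡ a)
    iter-const (suc r) a d = begin
      iter r (advance (λ _ → a)) d
        ≡⟨ iter-cong r (λ e → trans (sum-const (succ e) a) (cong (λ n → ι n * a) (length-succ e))) d ⟩
      iter r (λ _ → Q * a) d ≡⟨ iter-const r (Q * a) d ⟩
      Q ^ r * (Q * a)        ≡⟨ lemma Q (Q ^ r) a ⟩
      Q ^ suc r * a          ∎
      where
      open ≡-Reasoning
      lemma : ∀ a b c → b * (a * c) ≡ a * b * c
      lemma = solve-∀ ℚ-ring

    -- This is `layer-sum` for the constant function 1: every frontier dart has `q ^ r`
    -- continuations by `r` steps.
    tube-size : ∀ r → ι (length (tube (suc r))) ≡ ι (length frontier) * Q ^ r
    tube-size r = begin
      ι (length (tube (suc r)))                  ≡⟨ sym (ℚ.*-identityʳ _) ⟩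
      ι (length (tube (suc r))) * 1ℚ             ≡⟨ sym (sum-const (tube (suc r)) 1ℚ) ⟩
      sum (tube (suc r)) (λ _ → 1ℚ)              ≡⟨ tube-sum (suc r) (λ _ → 1ℚ) ⟩
      sum (layer (suc r)) (λ _ → 1ℚ)             ≡⟨ layer-sum r (λ _ → 1ℚ) ⟩
      sum frontier (iter r (λ _ → 1ℚ))           ≡⟨ Σℚ.sum-cong frontier (iter-const r 1ℚ) ⟩
      sum frontier (λ _ → Q ^ r * 1ℚ)            ≡⟨ sum-const frontier (Q ^ r * 1ℚ) ⟩
      ι (length frontier) * (Q ^ r * 1ℚ)         ≡⟨ cong (ι (length frontier) *_) (ℚ.*-identityʳ (Q ^ r)) ⟩
      ι (length frontier) * Q ^ r                ∎
      where open ≡-Reasoning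

    tube-sum-bound : ∀ r (k : Vertex G → ℚ) {K} → (∀ d → ∣ iter r (k ∘ target G) d ∣ ≤ Q ^ r * K) →
      ∣ sum (tube (suc r)) (k ∘ π G root) ∣ ≤ ι (length (tube (suc r))) * K
    tube-sum-bound r k {K} bound = subst₂ (λ s n → ∣ s ∣ ≤ n)
      (sym (trans (tube-sum (suc r) k) (layer-sum r k)))
      (trans (sym (ℚ.*-assoc (ι (length frontier)) (Q ^ r) K)) (cong (_* K) (sym (tube-size r))))
      (sum-abs-≤ frontier bound)

-- Means and square roots

ι*1/ : ∀ n → ι (suc n) * (+ 1 / suc n) ≡ 1ℚ
ι*1/ n = trans (cong (λ k → ι k * (+ 1 / suc n)) (sym (ℕ.*-identityˡ (suc n)))) (ι*u 1 n)

module _ {A : Set} where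

  meanℚ : List A → (A → ℚ) → ℚ
  meanℚ []          g = 0ℚ
  meanℚ xs@(_ ∷ ys) g = + 1 / suc (length ys) * sum xs g

  seq-∑ : ∀ (xs : List A) g n → seq (∑ xs g) n ≡ sum xs (λ x → seq (g x) n)
  seq-∑ []       g n = refl
  seq-∑ (x ∷ xs) g n = cong (λ t → seq (g x) n + t) (seq-∑ xs g n)

  seq-mean : ∀ (xs : List A) g n → seq (mean xs g) n ≡ meanℚ xs (λ x → seq (g x) n)
  seq-mean []          g n = refl
  seq-mean xs@(_ ∷ ys) g n = cong (+ 1 / suc (length ys) *_) (seq-∑ xs g n)

  sum≡length*mean : ∀ {xs : List A} {x} → x ∈ xs → ∀ g → sum xs g ≡ ι (length xs) * meanℚ xs g
  sum≡length*mean {xs@(_ ∷ ys)} _ g = begin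
    sum xs g                                                      ≡⟨ sym (ℚ.*-identityˡ _) ⟩
    1ℚ * sum xs g                                                 ≡⟨ cong (_* sum xs g) (sym (ι*1/ (length ys))) ⟩
    ι (suc (length ys)) * (+ 1 / suc (length ys)) * sum xs g      ≡⟨ ℚ.*-assoc (ι (suc (length ys))) (+ 1 / suc (length ys)) (sum xs g) ⟩
    ι (suc (length ys)) * ((+ 1 / suc (length ys)) * sum xs g)    ∎
    where open ≡-Reasoning

  sum-deviation : ∀ {xs : List A} {x} → x ∈ xs → ∀ g μ →
    sum xs (λ x → g x - μ) ≡ ι (length xs) * (meanℚ xs g - μ)
  sum-deviation {xs} x∈ g μ = begin
    sum xs (λ x → g x - μ)                                    ≡⟨ Σℚ.sum-∙ xs g (λ _ → - μ) ⟩
    sum xs g + sum xs (λ _ → - μ)                             ≡⟨ cong₂ _+_ (sum≡length*mean x∈ g) (sum-const xs (- μ)) ⟩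
    ι (length xs) * meanℚ xs g + ι (length xs) * (- μ)        ≡⟨ sym (ℚ.*-distribˡ-+ (ι (length xs)) _ _) ⟩
    ι (length xs) * (meanℚ xs g - μ)                          ∎
    where open ≡-Reasoning

  mean-deviation-≤ : ∀ {xs : List A} {x} → x ∈ xs → ∀ g μ {K} →
    ∣ sum xs (λ x → g x - μ) ∣ ≤ ι (length xs) * K → ∣ meanℚ xs g - μ ∣ ≤ K
  mean-deviation-≤ {xs@(_ ∷ ys)} x∈ g μ {K} bound =
    ℚ.*-cancelˡ-≤-pos (ι (length xs)) {{ℚ.normalize-pos (length xs) 1}}
      (subst (_≤ ι (length xs) * K) (begin
        ∣ sum xs (λ x → g x - μ) ∣                ≡⟨ cong ∣_∣ (sum-deviation x∈ g μ) ⟩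
        ∣ ι (length xs) * (meanℚ xs g - μ) ∣      ≡⟨ ℚ.∣p*q∣≡∣p∣*∣q∣ (ι (length xs)) _ ⟩
        ∣ ι (length xs) ∣ * ∣ meanℚ xs g - μ ∣    ≡⟨ cong (_* ∣ meanℚ xs g - μ ∣) (ℚ.0≤p⇒∣p∣≡p (0≤ι (length xs))) ⟩
        ι (length xs) * ∣ meanℚ xs g - μ ∣        ∎) bound)
    where open ≡-Reasoning

  ∣mean∣≤ : ∀ {xs : List A} {x} → x ∈ xs → ∀ {g K} → (∀ x → ∣ g x ∣ ≤ K) → ∣ meanℚ xs g ∣ ≤ K
  ∣mean∣≤ {xs} x∈ {g} {K} g≤K = subst (λ m → ∣ m ∣ ≤ K) (minus-0 (meanℚ xs g))
    (mean-deviation-≤ x∈ g 0ℚ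
      (sum-abs-≤ xs (λ x → subst (λ t → ∣ t ∣ ≤ K) (sym (minus-0 (g x))) (g≤K x))))
    where
    minus-0 : ∀ a → a - 0ℚ ≡ a
    minus-0 = solve-∀ ℚ-ring

∣-∣-≤+ : ∀ {p q a b} → ∣ p ∣ ≤ a → ∣ q ∣ ≤ b → ∣ p - q ∣ ≤ a + b
∣-∣-≤+ {p} {q} p≤ q≤ = ℚ.≤-trans (ℚ.∣p-q∣≤∣p∣+∣q∣ p q) (ℚ.+-mono-≤ p≤ q≤)

∣p∣*∣p∣≡p*p : ∀ p → ∣ p ∣ * ∣ p ∣ ≡ p * p
∣p∣*∣p∣≡p*p p with ℚ.∣p∣≡p∨∣p∣≡-p p
... | inj₁ eq = cong₂ _*_ eq eq
... | inj₂ eq = trans (cong₂ _*_ eq eq) (lemma p)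
  where
  lemma : ∀ a → - a * - a ≡ a * a
  lemma = solve-∀ ℚ-ring

-- A single square is at most the sum of squares, so the 2-norm bounds the supremum norm.
sum-squares-bound : {A : Set} {xs : List A} {h : A → ℚ} {t : ℚ} → 0ℚ ≤ t → sum xs (λ x → h x * h x) < t * t →
  ∀ {x} → x ∈ xs → ∣ h x ∣ ≤ t
sum-squares-bound {xs = xs} {h} {t} 0≤t Σ<t² {x} x∈ = ℚ.≮⇒≥ λ t<h → ℚ.<-irrefl refl
  (ℚ.<-≤-trans Σ<t² (ℚ.≤-trans (sq-mono 0≤t (ℚ.<⇒≤ t<h))
    (ℚ.≤-trans (ℚ.≤-reflexive (∣p∣*∣p∣≡p*p (h x))) (∈-≤-sum 0≤h² x∈))))
  where
  0≤h² : ∀ y → 0ℚ ≤ h y * h y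
  0≤h² y = subst (0ℚ ≤_) (∣p∣*∣p∣≡p*p (h y)) (0≤* (ℚ.0≤∣p∣ (h y)) (ℚ.0≤∣p∣ (h y)))

√-approx-≥0 : ∀ p n → 0ℚ ≤ √-approx p n
√-approx-≥0 p n = grid-≥0 p (+ 1 / suc n) (suc ℤ.∣ ℚ.↥ p ∣ ℕ.* suc n) (0≤u n)

-- `s` approximates the root from below and `s + u` from above. As `b ≤ 1`, the difference costs at
-- most `c * u`, and the mesh `u` is small enough for `ε`.
absorb-error : ∀ {x c s u b δ ε} → 0ℚ < c → b ≤ 1ℚ → 0ℚ ≤ u → u ≤ δ → c * δ ≡ ε →
  x ≤ c * (s + u) * b → x ≤ c * s * b + ε
absorb-error {x} {c} {s} {u} {b} {δ} {ε} 0<c b≤1 0≤u u≤δ cδ≡ε x≤ =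
  ℚ.≤-trans x≤ (ℚ.≤-trans (ℚ.≤-reflexive (lemma c s u b)) (ℚ.+-monoʳ-≤ (c * s * b) cub≤ε))
  where
  lemma : ∀ c s u b → c * (s + u) * b ≡ c * s * b + c * u * b
  lemma = solve-∀ ℚ-ring
  cub≤ε : c * u * b ≤ ε
  cub≤ε = ℚ.≤-trans (*-mono-≤ˡ (0≤* (ℚ.<⇒≤ 0<c) 0≤u) b≤1)
    (ℚ.≤-trans (ℚ.≤-reflexive (ℚ.*-identityʳ (c * u)))
      (ℚ.≤-trans (*-mono-≤ˡ (ℚ.<⇒≤ 0<c) u≤δ) (ℚ.≤-reflexive cδ≡ε)))

seq-^ : ∀ b r n → seq (fromℚ b ^ℝ r) n ≡ b ^ r
seq-^ b zero    n = refl
seq-^ b (suc r) n = cong (b *_) (seq-^ b r n)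

√-≥0 : ∀ x n → 0ℚ ≤ seq (√ x) n
√-≥0 x n = √-approx-≥0 (seq x n) n

√-upper : ∀ x n → seq x n < (seq (√ x) n + (+ 1 / suc n)) * (seq (√ x) n + (+ 1 / suc n))
√-upper x n = √-approx-upper (seq x n) n

difference-≤ℝ : ∀ x y z {c b} r → 0ℚ < c → 0ℚ ≤ b → b ≤ 1ℚ →
  (∀ n → ∣ seq x n - seq y n ∣ ≤ c * (seq (√ z) n + (+ 1 / suc n)) * b ^ r) →
  ∣ x -ℝ y ∣ℝ ≤ℝ fromℚ c *ℝ √ z *ℝ fromℚ b ^ℝ r
difference-≤ℝ x y z {c} {b} r 0<c 0≤b b≤1 bound ε ε>0 =
  let δ , δ>0 , cδ≡ε = divide c ε 0<c ε>0
      N , u≤δ = u≤ε δ δ>0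
  in N , λ n N≤n → subst (λ e → ∣ seq x n - seq y n ∣ ≤ c * seq (√ z) n * e + ε) (sym (seq-^ b r n))
    (absorb-error {s = seq (√ z) n} 0<c (^≤1 r 0≤b b≤1) (0≤u n) (u≤δ n N≤n) cδ≡ε (bound n))

module _ {A B : Set} (xs : List A) (p : A → B) (ys : List B) where

  -- The rational bound is applied to the `n`-th terms of `f`, with `t` the `n`-th term of the norm
  -- plus the mesh `1 / suc n`; the added mesh guarantees that the sum of squares is below `t * t`.
  mean-difference-≤ℝ : ∀ {c b} r → 0ℚ < c → 0ℚ ≤ b → b ≤ 1ℚ →
    (∀ (h : B → ℚ) {t} → 0ℚ ≤ t → (∀ {y} → y ∈ ys → ∣ h y ∣ ≤ t) →
      ∣ meanℚ xs (h ∘ p) - meanℚ ys h ∣ ≤ c * t * b ^ r) →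
    (f : B → ℝ) →
    ∣ mean xs (f ∘ p) -ℝ mean ys f ∣ℝ ≤ℝ fromℚ c *ℝ √ ∑ ys (λ y → f y *ℝ f y) *ℝ fromℚ b ^ℝ r
  mean-difference-≤ℝ {c} {b} r 0<c 0≤b b≤1 bound f =
    difference-≤ℝ (mean xs (f ∘ p)) (mean ys f) (∑ ys (λ y → f y *ℝ f y)) r 0<c 0≤b b≤1 λ n →
      subst₂ (λ a e → ∣ a - e ∣ ≤ c * t n * b ^ r) (sym (seq-mean xs (f ∘ p) n)) (sym (seq-mean ys f n))
        (bound (λ y → seq (f y) n) {t n} (0≤t n) (sum-squares-bound {h = λ y → seq (f y) n} (0≤t n) (Σ<t² n)))
    where
    t : ℕ → ℚ
    t n = seq (√ ∑ ys (λ y → f y *ℝ f y)) n + (+ 1 / suc n)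
    0≤t : ∀ n → 0ℚ ≤ t n
    0≤t n = 0≤+ (√-≥0 (∑ ys (λ y → f y *ℝ f y)) n) (0≤u n)
    Σ<t² : ∀ n → sum ys (λ y → seq (f y) n * seq (f y) n) < t n * t n
    Σ<t² n = subst (_< t n * t n) (seq-∑ ys (λ y → f y *ℝ f y) n) (√-upper (∑ ys (λ y → f y *ℝ f y)) n)

-- Otherwise the approximation `s` would satisfy `¾ * ¾ ≤ s * s ≤ 1 / q`; doubling gives
-- `9/8 ≤ 2 / q ≤ 1`.
√1/q≤¾ : ∀ q .{{_ : NonZero q}} → 2 ℕ.≤ q → ∀ n → √-approx (+ 1 / q) n ≤ ¾
√1/q≤¾ q@(suc q′) 2≤q n = ℚ.≮⇒≥ λ ¾<s → contradiction
  (ℚ.≤-trans (*-mono-≤ˡ (0≤ι 2) (ℚ.≤-trans (sq-mono 0≤¾ (ℚ.<⇒≤ ¾<s))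
      (grid-lower (+ 1 / q) (+ 1 / suc n) (suc ℤ.∣ ℚ.↥ (+ 1 / q) ∣ ℕ.* suc n) (ℚ.≤-<-trans 0≤¾ ¾<s))))
    (ℚ.≤-trans (*-mono-≤ʳ (0≤u q′) (ι-mono 2≤q)) (ℚ.≤-reflexive (ι*1/ q′))))
  (toWitnessFalse {a? = ι 2 * (¾ * ¾) ℚ.≤? 1ℚ} _)
  where
  ι-mono : ∀ {m n} → m ℕ.≤ n → ι m ≤ ι n
  ι-mono {n = n} z≤n = 0≤ι n
  ι-mono {suc m} {suc n} (s≤s m≤n) =
    subst₂ _≤_ (sym (ι-suc m)) (sym (ι-suc n)) (ℚ.+-monoˡ-≤ 1ℚ (ι-mono m≤n))

-- Equidistribution on tubes

module Equidistribution (G : Graph) {q : ℕ} (reg : Regular G (suc q)) (2≤q : 2 ℕ.≤ q)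
                        (M : ℕ) .{{_ : NonZero M}}
                        (reaches : ∀ d → Darts.Full G (Darts.Reg.reach-from G reg 2≤q M (d ∷ [])))
                        (R : Rate (ι q ^ M) M) where
  open Darts G
  open Reg reg
  open Dynamics G reg 2≤q
  open Mixing M reaches R
  open Rate R

  -- Each vertex is the target of `suc q` darts, so a function of mean zero on the vertices gives a
  -- centred function on the darts.
  target-sum : ∀ (k : Vertex G → ℚ) → sum (darts G) (k ∘ target G) ≡ ι (suc q) * sum (vertices G) k
  target-sum k = begin
    sum (darts G) (k ∘ target G)
      ≡⟨ Σℚ.sum-cong (darts G) (λ d → sym (trans (Σℚ.sum-↭ k (at d)) (ℚ.+-identityʳ _))) ⟩
    sum (darts G) (λ d → sum (filter (target G d Fin.≟_) (vertices G)) k)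
      ≡⟨ Σℚ.sum-filter-swap (λ d v → target G d Fin.≟ v) (darts G) (vertices G) (λ _ → k) ⟩
    sum (vertices G) (λ v → sum (incoming v) (λ _ → k v))
      ≡⟨ Σℚ.sum-cong (vertices G) (λ v → trans (sum-const (incoming v) (k v))
           (cong (λ n → ι n * k v) (length-incoming v))) ⟩
    sum (vertices G) (λ v → ι (suc q) * k v)
      ≡⟨ sum-*ˡ (vertices G) (ι (suc q)) k ⟩
    ι (suc q) * sum (vertices G) k ∎
    where
    open ≡-Reasoning
    at : ∀ d → filter (target G d Fin.≟_) (vertices G) ↭ target G d ∷ []
    at d = unique-set⇒↭ (Unique.filter⁺ (target G d Fin.≟_) (Unique.allFin⁺ _)) ([] ∷ [])
      (λ v∈ → here (sym (proj₂ (∈-filter⁻ (target G d Fin.≟_) {xs = vertices G} v∈))))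
      (λ { (here refl) → ∈-filter⁺ (target G d Fin.≟_) (∈-allFin _) refl })

  -- The 2 comes from `∣ h v - μ ∣ ≤ t + t`, the power of `4/3` from the incomplete block, and the
  -- single `4/3` from running one step of the shift fewer than the radius.
  constant : ℚ
  constant = ι 2 * (4/3 * 4/3 ^ M)

  1≤4/3 : 1ℚ ≤ 4/3
  1≤4/3 = ≤-by (+ 1 / 3) (ℚ.nonNegative⁻¹ (+ 1 / 3)) refl

  2≤constant : ι 2 ≤ constant
  2≤constant = subst (_≤ constant) (ℚ.*-identityʳ (ι 2)) (*-mono-≤ˡ (0≤ι 2) (1≤^ (suc M) 1≤4/3))

  0<constant : 0ℚ < constant
  0<constant = ℚ.<-≤-trans (ℚ.positive⁻¹ (ι 2)) 2≤constant

  1≤4/3*rate : 1ℚ ≤ 4/3 * rate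
  1≤4/3*rate = ℚ.≤-trans (ℚ.≤-reflexive refl) (*-mono-≤ˡ (ℚ.≤-trans 0≤1 1≤4/3) ¾≤rate)

  module _ {root : Vertex G} (X : FiniteSubgraph G root) {x₀ : CoverVertex G root} (x₀∈ : x₀ ∈ vertexList X)
           (connected : ConnectedSubgraph G root X) where
    open Tubes G root X x₀∈ connected
    open Growth reg 2≤q

    tube-mean : ∀ r {h : Vertex G → ℚ} {t} → 0ℚ ≤ t → (∀ v → ∣ h v ∣ ≤ t) →
      ∣ meanℚ (tube r) (h ∘ π G root) - meanℚ (vertices G) h ∣ ≤ constant * t * rate ^ r
    tube-mean r {h} {t} 0≤t h≤t = mean-deviation-≤ (proj₂ (tube-nonempty r)) (h ∘ π G root) μ (bound r)
      where
      μ : ℚ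
      μ = meanℚ (vertices G) h
      μ≤t : ∣ μ ∣ ≤ t
      μ≤t = ∣mean∣≤ (∈-allFin root) h≤t
      k : Vertex G → ℚ
      k v = h v - μ
      k≤ : ∀ v → ∣ k v ∣ ≤ t + t
      k≤ v = ∣-∣-≤+ (h≤t v) μ≤t
      k-sum : sum (vertices G) k ≡ 0ℚ
      k-sum = trans (sum-deviation (∈-allFin root) h μ)
        (trans (cong (ι (length (vertices G)) *_) (ℚ.+-inverseʳ μ)) (ℚ.*-zeroʳ (ι (length (vertices G)))))
      centred : Centred (k ∘ target G)
      centred = trans (target-sum k) (trans (cong (ι (suc q) *_) k-sum) (ℚ.*-zeroʳ (ι (suc q))))
      doubled : t + t ≡ ι 2 * t
      doubled = trans (twice t) (cong (_* t) 1+1≡2)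
        where
        twice : ∀ t → t + t ≡ (1ℚ + 1ℚ) * t
        twice = solve-∀ ℚ-ring
        1+1≡2 : 1ℚ + 1ℚ ≡ ι 2
        1+1≡2 = refl
      bound : ∀ r → ∣ sum (tube r) (k ∘ π G root) ∣ ≤ ι (length (tube r)) * (constant * t * rate ^ r)
      -- At radius 0 the trivial bound `t + t` suffices, as `constant` is at least 2.
      bound zero = ℚ.≤-trans (sum-abs-≤ (tube 0) (k≤ ∘ π G root)) (*-mono-≤ˡ (0≤ι (length (tube 0)))
        (ℚ.≤-trans (ℚ.≤-reflexive doubled) (ℚ.≤-trans (*-mono-≤ʳ 0≤t 2≤constant)
          (ℚ.≤-reflexive (sym (ℚ.*-identityʳ (constant * t)))))))
      -- Only `r` steps of the shift are available at radius `suc r`; `1 ≤ 4/3 * rate` supplies the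
      -- missing factor `rate`.
      bound (suc r) = ℚ.≤-trans
        (tube-sum-bound r k {K = 4/3 ^ M * rate ^ r * (t + t)} (λ d →
          ℚ.≤-trans (exponential-decay r (0≤+ 0≤t 0≤t) centred (k≤ ∘ target G) d)
            (ℚ.≤-reflexive (ℚ.*-assoc (Q ^ r) (4/3 ^ M * rate ^ r) (t + t)))))
        (*-mono-≤ˡ (0≤ι (length (tube (suc r))))
          (subst₂ _≤_ (trans (ℚ.*-identityˡ _) (cong (4/3 ^ M * rate ^ r *_) (sym doubled)))
              (lemma (ι 2) 4/3 (4/3 ^ M) t rate (rate ^ r))
            (*-mono-≤ʳ (0≤* (0≤* (0≤^ M (ℚ.≤-trans 0≤1 1≤4/3)) (0≤^ r 0≤rate)) (0≤* (0≤ι 2) 0≤t)) 1≤4/3*rate)))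
        where
        lemma : ∀ w f c t b p → f * b * (c * p * (w * t)) ≡ w * (f * c) * t * (b * p)
        lemma = solve-∀ ℚ-ring

    tube-mean-ℝ : (f : Vertex G → ℝ) (r : ℕ) →
      ∣ mean (tube r) (f ∘ π G root) -ℝ mean (vertices G) f ∣ℝ ≤ℝ fromℚ constant *ℝ norm₂ G f *ℝ fromℚ rate ^ℝ r
    tube-mean-ℝ f r = mean-difference-≤ℝ (tube r) (π G root) (vertices G) r 0<constant 0≤rate rate≤1
      (λ h 0≤t h≤t → tube-mean r 0≤t (λ v → h≤t (∈-allFin v))) f

  √1/q≤rate : .{{_ : NonZero q}} → √ fromℚ (+ 1 / q) ≤ℝ fromℚ rate
  √1/q≤rate ε ε>0 = 0 , λ n _ → ℚ.≤-trans (√1/q≤¾ q 2≤q n) (ℚ.≤-trans ¾≤rate (≤-by ε (ℚ.<⇒≤ ε>0) refl))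

  rate<1 : fromℚ rate <ℝ 1ℝ
  rate<1 = gap , 0<gap , 0 , λ _ _ → ℚ.≤-reflexive (lemma gap)
    where
    lemma : ∀ a → 1ℚ - a + a ≡ 1ℚ
    lemma = solve-∀ ℚ-ring

  0<constantℝ : 0ℝ <ℝ fromℚ constant
  0<constantℝ = constant , 0<constant , 0 , λ _ _ → ℚ.≤-reflexive (ℚ.+-identityˡ constant)

corollary5 : (G : Graph) → Connected G → ¬ Bipartite G →
    (q : ℕ) → .{{_ : NonZero q}} → 3 ℕ.≤ suc q → Regular G (suc q) →
    ∃[ β ] √ fromℚ (+ 1 / q) ≤ℝ β × β <ℝ 1ℝ ×
    ((root : Vertex G) (X : FiniteSubgraph G root) →
    NonemptySubgraph G root X → ConnectedSubgraph G root X →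
    ∃[ C ] 0ℝ <ℝ C ×
    ((f : Vertex G → ℝ) (r : ℕ) →
    ∣ mean (elements (𝓣 G root r X)) (f ∘ π G root) -ℝ mean (vertices G) f ∣ℝ
    ≤ℝ C *ℝ norm₂ G f *ℝ β ^ℝ r))
corollary5 G connected nonbip q (s≤s 2≤q) reg =
  fromℚ (Rate.rate R) , √1/q≤rate , rate<1 , λ root X (x₀ , x₀∈) X-connected →
    fromℚ constant , 0<constantℝ , tube-mean-ℝ X x₀∈ X-connected
  where
  M : ℕ
  M = Darts.Reg.mixing-time G reg 2≤q connected nonbip
  R : Rate (ι q ^ M) M
  R = rate-exists M (1≤^ M (Dynamics.1≤Q G reg 2≤q))
  open Equidistribution G reg 2≤q M (Darts.Reg.reach-full G reg 2≤q connected nonbip) R
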